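{- There exists an infinite set $\mathcal{S}$ of primes, having density $\frac{1}{9}$ within the set of all primes, such that for every prime $p \in \mathcal{S}$ the projective norm graph $\mathcal{P}(p,4)$ contains a copy of the complete bipartite graph $K_{4,6}$ (as a subgraph).
   Context: For $t \geq 3$ and a prime power $q$, the projective norm graph $\mathcal{P}(q,t)$ is the graph with vertex set $\mathbb{F}_{q^{t-1}} \times \mathbb{F}_q^*$, in which two distinct vertices $(\alpha,a)$ and $(\beta,b)$ are adjacent if and only if $N(\alpha+\beta) = ab$, where $N$ denotes the norm map of the field extension $\mathbb{F}_{q^{t-1}}/\mathbb{F}_q$. A set of primes has density $\delta$ if the proportion of primes up to $x$ that lie in it tends to $\delta$ as $x \to \infty$. -}

module Defs where

open import Level using (0ℓ)
open import Data.Nat using (ℕ; zero; suc; _≤_; _<_; _∸_)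
import Data.Nat as N
open import Data.Nat.Primality using (Prime; prime?)
open import Data.Integer using (ℤ; +_; _-_; ∣_∣)
open import Data.Fin using (Fin)
open import Data.Product using (Σ; ∃; _×_; _,_)
open import Relation.Nullary using (¬_; yes; no)
open import Relation.Unary using (Pred; Decidable)
open import Relation.Binary.PropositionalEquality using (_≡_)
import Relation.Binary.PropositionalEquality as ≡
open import Algebra.Bundles using (CommutativeRing)
open import Function.Bundles using (Bijection)

countPrimesIn : (S : Pred ℕ 0ℓ) → Decidable S → ℕ → ℕ
countPrimesIn S S? zero = 0
countPrimesIn S S? (suc x) with prime? (suc x) | S? (suc x)
... | yes _ | yes _ = suc (countPrimesIn S S? x)
... | _     | _     = countPrimesIn S S? x

primeCount : ℕ → ℕ
primeCount zero = 0
primeCount (suc x) with prime? (suc x)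
... | yes _ = suc (primeCount x)
... | no  _ = primeCount x

-- S has density a/b (b ≠ 0) within the primes:
-- count_S(x)/π(x) → a/b, i.e. for every ε = 1/(k+1) there is N with
-- |count_S(x)/π(x) − a/b| < 1/(k+1) for all x ≥ N, written without division as
-- (k+1)·|b·count_S(x) − a·π(x)| < b·π(x).
HasPrimeDensity : (S : Pred ℕ 0ℓ) → Decidable S → (a b : ℕ) → Set
HasPrimeDensity S S? a b =
  ∀ (k : ℕ) → ∃ λ (N : ℕ) → ∀ (x : ℕ) → N ≤ x →
    suc k N.* ∣ + (b N.* countPrimesIn S S? x) - + (a N.* primeCount x) ∣ < b N.* primeCount x

Infinite : Pred ℕ 0ℓ → Set
Infinite S = ∀ (n : ℕ) → ∃ λ (p : ℕ) → n < p × S p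

record IsField (R : CommutativeRing 0ℓ 0ℓ) : Set where
  open CommutativeRing R
  field
    0≉1     : ¬ (0# ≈ 1#)
    inverse : ∀ x → ¬ (x ≈ 0#) → ∃ λ y → x * y ≈ 1#

HasOrder : CommutativeRing 0ℓ 0ℓ → ℕ → Set
HasOrder R n = Bijection (≡.setoid (Fin n)) (CommutativeRing.setoid R)

-- Projective norm graph P(q,t) realised inside a field K with |K| = q^(t-1)

module NormGraph (K : CommutativeRing 0ℓ 0ℓ) (q t : ℕ) where
  open CommutativeRing K

  pow : Carrier → ℕ → Carrier
  pow x zero    = 1#
  pow x (suc n) = x * pow x n

  -- N(α) = α^(1 + q + ... + q^(t-2)) for the extension F_{q^(t-1)}/F_q
  normExp : ℕ → ℕ
  normExp zero    = 0
  normExp (suc i) = q N.^ i N.+ normExp i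

  norm : Carrier → Carrier
  norm α = pow α (normExp (t ∸ 1))

  -- F_q^* is the set of nonzero a with a^(q-1) = 1 (the multiplicative
  -- group of the unique subfield of order q)
  InFqStar : Carrier → Set
  InFqStar a = ¬ (a ≈ 0#) × pow a (q ∸ 1) ≈ 1#

  Vertex : Set
  Vertex = Carrier × Σ Carrier InFqStar

  _≈V_ : Vertex → Vertex → Set
  (α , a , _) ≈V (β , b , _) = α ≈ β × a ≈ b

  Adj : Vertex → Vertex → Set
  Adj u@(α , a , _) v@(β , b , _) = ¬ (u ≈V v) × norm (α + β) ≈ a * b

  ContainsKmn : ℕ → ℕ → Set
  ContainsKmn m n =
    Σ (Fin m → Vertex) λ f → Σ (Fin n → Vertex) λ g →
      (∀ i j → f i ≈V f j → i ≡ j) ×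
      (∀ i j → g i ≈V g j → i ≡ j) ×
      (∀ i j → ¬ (f i ≈V g j)) ×
      (∀ i j → Adj (f i) (g j))

{-# OPTIONS --safe #-}
-- Let x ∈ F_{p³} satisfy x^p = -1/(1 + x). Then N(x) = 1 and N(1 + x) = -1, and the same holds for
-- the solutions of x^p = -(1 + x)/x. From one x we get three points of the first kind,
--   x,  (x - 1)/(x + 2),  (2x + 1)/(x² - 1),
-- and their images under x ↦ -1 - x are three points of the second kind. The norm of P - θ, for
--   θ = 2(x² + x + 1)/((x - 1)(x + 2)),
-- is the same at all six points P: up to factors of known norm, each P - θ is a conjugate of
-- x² - 2x - 2. Hence the norms of the differences between the points P and the points ∞, 0, -1, θ
-- form a matrix of rank one, and P ↦ 6/(P - 2) moves this configuration away from ∞ to a K_{4,6}.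
-- (In the coordinate β = (x - ω)/(x - ω²), with ω² + ω + 1 = 0, the six points are β, -ωβ, ω²β⁻²
-- and their images under β ↦ β⁻¹.)
--
-- This works for every prime p > 200, so S may consist of every ninth prime.
module Submission where

open import Defs
open import Level using (0ℓ)
open import Algebra.Bundles using (CommutativeRing)
open import Data.Empty using (⊥; ⊥-elim)
open import Data.Fin as Fin using (Fin; zero; suc; toℕ; fromℕ)
open import Data.Fin.Patterns
open import Data.Fin.Permutation using (Permutation; permutation)
import Data.Fin.Properties as Fin
open import Data.Integer as ℤ using (ℤ; +_; -[1+_])
import Data.Integer.Properties as ℤ
open import Data.List using (List; []; _∷_)
open import Data.List.Relation.Unary.All using ([]; _∷_)
open import Data.Maybe using (Maybe; just; nothing)
open import Data.Nat as ℕ using (ℕ; zero; suc; _≤_; _<_; s≤s; z≤n; _∸_)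
open import Data.Nat.Combinatorics using (_C_; nCn≡1; nCk≡n!/k![n-k]!; k![n∸k]!∣n!)
open import Data.Nat.Coprimality using (prime⇒coprime; coprime-Bézout)
open import Data.Nat.Divisibility
  using (_∣_; _∣?_; divides; m∣m*n; n∣m*n; ∣⇒≤; ∣-trans; ∣1⇒≡1; ∣m+n∣m⇒∣n; >⇒∤)
open import Data.Nat.DivMod using (m*[n/m]≡n)
open import Data.Nat.GCD using (module Bézout)
import Data.Nat.ListAction as ListAction
open import Data.Nat.Primality
  using (Prime; prime?; euclidsLemma; prime⇒nonZero; prime⇒nonTrivial; ¬prime[0]; ¬prime[1])
open import Data.Nat.Primality.Factorisation using (factorise)
import Data.Nat.Properties as ℕ
import Data.Nat.Tactic.RingSolver as ℕSolver
open import Data.Product using (∃; _×_; _,_; proj₁; proj₂)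
open import Data.Sum using (inj₁; inj₂)
open import Data.Vec as Vec using (Vec; []; _∷_)
open import Data.Vec.Functional using (removeAt; replicate)
open import Function using (_∘_)
open import Function.Bundles using (Bijection)
open import Relation.Binary.Definitions using (tri<; tri≈; tri>)
open import Relation.Binary.PropositionalEquality as ≡ using (_≡_)
open import Relation.Nullary using (¬_; Dec; yes; no; ¬?; contradiction)
open import Relation.Nullary.Decidable using (True; toWitness; from-yes; decidable-stable; _×-dec_)
open import Relation.Unary using (Pred; Decidable)

-- Arithmetic in a field of order p³

-- Norms lie in the base field, so a K_{4,6} needs only elements A_i and B_j for which the matrix
-- N(A_i + B_j) has rank one: its row and column factors serve as second coordinates of the
-- vertices. Rank one survives Möbius transformations, because these multiply a difference P - a by
-- one factor depending on P and one depending on a. The numerator 6 and the pole 2 of the final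
-- transformation are chosen so that the images of the four points are polynomials in x. Since x ↦
-- -1/(1 + x) has integer coefficients, φ takes a polynomial in x to a rational function of x. Every
-- comparison of norms therefore comes down to identities between polynomials in x, which hold over
-- the integers. The obstacle is a degenerate x. For p ≡ 1 mod 3 the rotation x ↦ -1/(1 + x) has
-- fixed points in the base field, where its equation is solved to no use; an eigenvector of φ then
-- supplies another solution. Moreover, for four values of the trace of x two of the six points
-- coincide, and x has to be exchanged for another solution.

module IntegerCoefficients (K : CommutativeRing 0ℓ 0ℓ) where
  open CommutativeRing K
  open import Algebra.Properties.Ring ring using (-‿distribˡ-*; -‿distribʳ-*)
  open import Algebra.Properties.AbelianGroup +-abelianGroup
    using (⁻¹-∙-comm; ⁻¹-involutive; ε⁻¹≈ε)
  open import Algebra.Properties.Semiring.Mult semiring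
    using (×-homo-+; ×-homo-1; ×1-homo-*) renaming (_×_ to _·_)
  open import Relation.Binary.Reasoning.Setoid setoid
  open import Algebra.Solver.Ring.AlmostCommutativeRing
    using (fromCommutativeRing; _-Raw-AlmostCommutative⟶_)

  ⟦_⟧ : ℤ → Carrier
  ⟦ + n ⟧      = n · 1#
  ⟦ -[1+ n ] ⟧ = - (suc n · 1#)

  ⟦⟧-⊖ : ∀ m n → ⟦ m ℤ.⊖ n ⟧ ≈ m · 1# - n · 1#
  ⟦⟧-⊖ m zero = sym (trans (+-congˡ ε⁻¹≈ε) (+-identityʳ _))
  ⟦⟧-⊖ zero (suc n) = sym (+-identityˡ _)
  ⟦⟧-⊖ (suc m) (suc n) = begin
    ⟦ suc m ℤ.⊖ suc n ⟧                      ≡⟨ ≡.cong ⟦_⟧ (ℤ.[1+m]⊖[1+n]≡m⊖n m n) ⟩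
    ⟦ m ℤ.⊖ n ⟧                              ≈⟨ ⟦⟧-⊖ m n ⟩
    m · 1# - n · 1#                          ≈⟨ +-identityˡ _ ⟨
    0# + (m · 1# - n · 1#)                   ≈⟨ +-congʳ (-‿inverseʳ 1#) ⟨
    (1# - 1#) + (m · 1# - n · 1#)            ≈⟨ +-assoc _ _ _ ⟩
    1# + (- 1# + (m · 1# - n · 1#))          ≈⟨ +-congˡ (+-assoc _ _ _) ⟨
    1# + (- 1# + m · 1# - n · 1#)            ≈⟨ +-congˡ (+-congʳ (+-comm _ _)) ⟩
    1# + (m · 1# - 1# - n · 1#)              ≈⟨ +-congˡ (+-assoc _ _ _) ⟩
    1# + (m · 1# + (- 1# - n · 1#))          ≈⟨ +-assoc _ _ _ ⟨
    suc m · 1# + (- 1# - n · 1#)             ≈⟨ +-congˡ (⁻¹-∙-comm _ _) ⟩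
    suc m · 1# - suc n · 1#                  ∎

  ⟦⟧-+ : ∀ i j → ⟦ i ℤ.+ j ⟧ ≈ ⟦ i ⟧ + ⟦ j ⟧
  ⟦⟧-+ (+ m) (+ n) = ×-homo-+ 1# m n
  ⟦⟧-+ (+ m) -[1+ n ] = ⟦⟧-⊖ m (suc n)
  ⟦⟧-+ -[1+ m ] (+ n) = trans (⟦⟧-⊖ n (suc m)) (+-comm _ _)
  ⟦⟧-+ -[1+ m ] -[1+ n ] = begin
    - (suc (suc (m ℕ.+ n)) · 1#)     ≈⟨ -‿cong (+-congˡ (×-homo-+ 1# (suc m) n)) ⟩
    - (1# + (suc m · 1# + n · 1#))   ≈⟨ -‿cong (+-assoc _ _ _) ⟨
    - (1# + suc m · 1# + n · 1#)     ≈⟨ -‿cong (+-congʳ (+-comm _ _)) ⟩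
    - (suc m · 1# + 1# + n · 1#)     ≈⟨ -‿cong (+-assoc _ _ _) ⟩
    - (suc m · 1# + suc n · 1#)      ≈⟨ ⁻¹-∙-comm _ _ ⟨
    - (suc m · 1#) - suc n · 1#      ∎

  ⟦⟧-neg : ∀ i → ⟦ ℤ.- i ⟧ ≈ - ⟦ i ⟧
  ⟦⟧-neg (+ zero) = sym ε⁻¹≈ε
  ⟦⟧-neg (+ suc n) = refl
  ⟦⟧-neg -[1+ n ] = sym (⁻¹-involutive _)

  ⟦⟧-* : ∀ i j → ⟦ i ℤ.* j ⟧ ≈ ⟦ i ⟧ * ⟦ j ⟧
  ⟦⟧-* (+ m) (+ n) = begin
    ⟦ + m ℤ.* + n ⟧          ≡⟨ ≡.cong ⟦_⟧ (ℤ.pos-* m n) ⟨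
    (m ℕ.* n) · 1#           ≈⟨ ×1-homo-* m n ⟩
    m · 1# * n · 1#          ∎
  ⟦⟧-* (+ m) -[1+ n ] = begin
    ⟦ + m ℤ.* (ℤ.- + suc n) ⟧      ≡⟨ ≡.cong ⟦_⟧ (ℤ.neg-distribʳ-* (+ m) (+ suc n)) ⟨
    ⟦ ℤ.- (+ m ℤ.* + suc n) ⟧      ≈⟨ ⟦⟧-neg (+ m ℤ.* + suc n) ⟩
    - ⟦ + m ℤ.* + suc n ⟧          ≈⟨ -‿cong (⟦⟧-* (+ m) (+ suc n)) ⟩
    - (m · 1# * suc n · 1#)        ≈⟨ -‿distribʳ-* _ _ ⟩
    m · 1# * - (suc n · 1#)        ∎
  ⟦⟧-* -[1+ m ] (+ n) = begin
    ⟦ (ℤ.- + suc m) ℤ.* + n ⟧      ≡⟨ ≡.cong ⟦_⟧ (ℤ.neg-distribˡ-* (+ suc m) (+ n)) ⟨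
    ⟦ ℤ.- (+ suc m ℤ.* + n) ⟧      ≈⟨ ⟦⟧-neg (+ suc m ℤ.* + n) ⟩
    - ⟦ + suc m ℤ.* + n ⟧          ≈⟨ -‿cong (⟦⟧-* (+ suc m) (+ n)) ⟩
    - (suc m · 1# * n · 1#)        ≈⟨ -‿distribˡ-* _ _ ⟩
    - (suc m · 1#) * n · 1#        ∎
  ⟦⟧-* -[1+ m ] -[1+ n ] = begin
    (suc m ℕ.* suc n) · 1#             ≈⟨ ×1-homo-* (suc m) (suc n) ⟩
    suc m · 1# * suc n · 1#            ≈⟨ ⁻¹-involutive _ ⟨
    - - (suc m · 1# * suc n · 1#)      ≈⟨ -‿cong (-‿distribˡ-* _ _) ⟩
    - (- (suc m · 1#) * suc n · 1#)    ≈⟨ -‿distribʳ-* _ _ ⟩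
    - (suc m · 1#) * - (suc n · 1#)    ∎

  private
    -- Coefficients come from ℤ so that numerals are added, multiplied and compared by computation,
    -- which the abstract operations of K do not allow.
    morphism : ℤ.+-*-rawRing -Raw-AlmostCommutative⟶ fromCommutativeRing K
    morphism = record
      { ⟦_⟧    = ⟦_⟧
      ; +-homo = ⟦⟧-+
      ; *-homo = ⟦⟧-*
      ; -‿homo = ⟦⟧-neg
      ; 0-homo = refl
      ; 1-homo = ×-homo-1 1#
      }

    coefficientsEqual? : ∀ i j → Maybe (⟦ i ⟧ ≈ ⟦ j ⟧)
    coefficientsEqual? i j with i ℤ.≟ j
    ... | yes i≡j = just (reflexive (≡.cong ⟦_⟧ i≡j))
    ... | no  _   = nothing

  open import Algebra.Solver.Ring ℤ.+-*-rawRing (fromCommutativeRing K) morphism coefficientsEqual? public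
    using (solve; _:=_; _:+_; _:*_; _:-_; :-_; con; Polynomial)

-- Divisibility of binomial coefficients by a prime

prime∤! : ∀ {p} → Prime p → ∀ k → k < p → ¬ (p ∣ k ℕ.!)
prime∤! pr zero _ p∣1 = ¬prime[1] (≡.subst Prime (∣1⇒≡1 p∣1) pr)
prime∤! pr (suc k) k<p p∣ with euclidsLemma (suc k) (k ℕ.!) pr p∣
... | inj₁ p∣1+k = ℕ.<⇒≱ k<p (∣⇒≤ p∣1+k)
... | inj₂ p∣k!  = prime∤! pr k (ℕ.<-trans (ℕ.n<1+n k) k<p) p∣k!

-- The prime p divides p! = k! (p - k)! C(p, k), but neither of the two factorials, both being of
-- numbers below p.
prime∣C : ∀ {p} → Prime p → ∀ k → 0 < k → k < p → p ∣ p C k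
prime∣C {suc p-1} pr k 0<k k<p
  with euclidsLemma (k ℕ.! ℕ.* (p ∸ k) ℕ.!) (p C k) pr p∣product
  where
  p = suc p-1
  instance _ = k ℕ.!* (p ∸ k) !≢0
  p∣product : p ∣ k ℕ.! ℕ.* (p ∸ k) ℕ.! ℕ.* (p C k)
  p∣product = ≡.subst (p ∣_)
    (≡.sym (≡.trans (≡.cong (k ℕ.! ℕ.* (p ∸ k) ℕ.! ℕ.*_) (nCk≡n!/k![n-k]! (ℕ.<⇒≤ k<p)))
                    (m*[n/m]≡n (k![n∸k]!∣n! (ℕ.<⇒≤ k<p)))))
    (m∣m*n (p-1 ℕ.!))
... | inj₂ p∣C = p∣C
... | inj₁ p∣d with euclidsLemma (k ℕ.!) ((suc p-1 ∸ k) ℕ.!) pr p∣d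
...   | inj₁ p∣k!   = contradiction p∣k! (prime∤! pr k k<p)
...   | inj₂ p∣p-k! = contradiction p∣p-k!
  (prime∤! pr (suc p-1 ∸ k) (ℕ.∸-monoʳ-< 0<k (ℕ.<⇒≤ k<p)))

-- Cancellation in fields and Fermat's theorem in finite fields

module FieldProperties (K : CommutativeRing 0ℓ 0ℓ) (isField : IsField K) where
  open CommutativeRing K hiding (zero)
  open IsField isField
  open import Algebra.Properties.CommutativeSemiring.Exp commutativeSemiring using (_^_)
  open import Relation.Binary.Reasoning.Setoid setoid
  open import Algebra.Properties.AbelianGroup +-abelianGroup
    using (x∙y⁻¹≈ε⇒x≈y; x≈y⇒x∙y⁻¹≈ε)

  *-cancelˡ : ∀ {x y z} → ¬ (x ≈ 0#) → x * y ≈ x * z → y ≈ z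
  *-cancelˡ {x} {y} {z} x≉0 eq with inverse x x≉0
  ... | x⁻¹ , xx⁻¹ = begin
    y             ≈⟨ *-identityˡ y ⟨
    1# * y        ≈⟨ *-congʳ (trans (*-comm _ _) xx⁻¹) ⟨
    x⁻¹ * x * y   ≈⟨ *-assoc _ _ _ ⟩
    x⁻¹ * (x * y) ≈⟨ *-congˡ eq ⟩
    x⁻¹ * (x * z) ≈⟨ *-assoc _ _ _ ⟨
    x⁻¹ * x * z   ≈⟨ *-congʳ (trans (*-comm _ _) xx⁻¹) ⟩
    1# * z        ≈⟨ *-identityˡ z ⟩
    z             ∎

  *-cancelʳ : ∀ {x y z} → ¬ (x ≈ 0#) → y * x ≈ z * x → y ≈ z
  *-cancelʳ x≉0 eq = *-cancelˡ x≉0 (trans (*-comm _ _) (trans eq (*-comm _ _)))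

  x*y≈0⇒y≈0 : ∀ {x y} → ¬ (x ≈ 0#) → x * y ≈ 0# → y ≈ 0#
  x*y≈0⇒y≈0 x≉0 eq = *-cancelˡ x≉0 (trans eq (sym (zeroʳ _)))

  *-≉0 : ∀ {x y} → ¬ (x ≈ 0#) → ¬ (y ≈ 0#) → ¬ (x * y ≈ 0#)
  *-≉0 x≉0 y≉0 eq = y≉0 (x*y≈0⇒y≈0 x≉0 eq)

  ^-≉0 : ∀ {x} n → ¬ (x ≈ 0#) → ¬ (x ^ n ≈ 0#)
  ^-≉0 zero    x≉0 eq = 0≉1 (sym eq)
  ^-≉0 (suc n) x≉0 = *-≉0 x≉0 (^-≉0 n x≉0)

  ≉0-cong : ∀ {x y} → x ≈ y → ¬ (x ≈ 0#) → ¬ (y ≈ 0#)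
  ≉0-cong x≈y x≉0 y≈0 = x≉0 (trans x≈y y≈0)

  x≈y⇒x-y≈0 : ∀ {x y} → x ≈ y → x - y ≈ 0#
  x≈y⇒x-y≈0 = x≈y⇒x∙y⁻¹≈ε

  x-y≈0⇒x≈y : ∀ {x y} → x - y ≈ 0# → x ≈ y
  x-y≈0⇒x≈y = x∙y⁻¹≈ε⇒x≈y _ _

  module FiniteField (m : ℕ) (order : HasOrder K (suc m)) where
    open Bijection order using (to; injective; surjective) renaming (cong to to-cong)
    open import Algebra.Properties.Semiring.Mult semiring using () renaming (_×_ to _·_)

    index : Carrier → Fin (suc m)
    index x = proj₁ (surjective x)

    to-index : ∀ x → to (index x) ≈ x
    to-index x = proj₂ (surjective x) ≡.refl

    index-to : ∀ {x} i → x ≈ to i → index x ≡ i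
    index-to i x≈ = injective (trans (to-index _) x≈)

    infix 4 _≟_
    _≟_ : ∀ x y → Dec (x ≈ y)
    x ≟ y with index x Fin.≟ index y
    ... | yes eq = yes (trans (sym (to-index x)) (trans (to-cong eq) (to-index y)))
    ... | no  ne = no λ x≈y → ne (index-to _ (trans x≈y (sym (to-index y))))

    -- Transports a bijection of K to the indices, so that sums and products over all of K can be
    -- reindexed along it.
    module Permuted (f g : Carrier → Carrier)
      (f-cong : ∀ {x y} → x ≈ y → f x ≈ f y) (g-cong : ∀ {x y} → x ≈ y → g x ≈ g y)
      (fg : ∀ x → f (g x) ≈ x) (gf : ∀ x → g (f x) ≈ x) where

      π : Permutation (suc m) (suc m)
      π = permutation (λ i → index (f (to i))) (λ i → index (g (to i)))
        (λ i → index-to i (trans (f-cong (to-index _)) (fg _)))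
        (λ i → index-to i (trans (g-cong (to-index _)) (gf _)))

    -- Translation by 1 permutes K, so the sum of all elements does not change when 1 is added to
    -- each of them.
    order·1≈0 : suc m · 1# ≈ 0#
    order·1≈0 = sym (begin
      0#                                          ≈⟨ -‿inverseˡ _ ⟨
      - sum to + sum to                           ≈⟨ +-congˡ (sum-permute to π) ⟩
      - sum to + sum (λ i → to (index (to i + 1#))) ≈⟨ +-congˡ (sum-cong-≋ (λ i → to-index (to i + 1#))) ⟩
      - sum to + sum (λ i → to i + 1#)            ≈⟨ +-congˡ (∑-distrib-+ to (replicate (suc m) 1#)) ⟩
      - sum to + (sum to + sum (replicate (suc m) 1#)) ≈⟨ +-assoc _ _ _ ⟨
      - sum to + sum to + sum (replicate (suc m) 1#)   ≈⟨ +-congʳ (-‿inverseˡ _) ⟩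
      0# + sum (replicate (suc m) 1#)             ≈⟨ +-identityˡ _ ⟩
      sum (replicate (suc m) 1#)                  ≈⟨ sum-replicate (suc m) ⟩
      suc m · 1#                                  ∎)
      where
      open import Algebra.Properties.CommutativeMonoid.Sum +-commutativeMonoid
      open Permuted (_+ 1#) (_- 1#) +-congʳ +-congʳ
        (λ x → trans (+-assoc _ _ _) (trans (+-congˡ (-‿inverseˡ 1#)) (+-identityʳ x)))
        (λ x → trans (+-assoc _ _ _) (trans (+-congˡ (-‿inverseʳ 1#)) (+-identityʳ x)))

    -- Multiplication by x permutes K and fixes 0, so it preserves the product of all elements once
    -- 0 is replaced by 1.
    x^m≈1 : ∀ {x} → ¬ (x ≈ 0#) → x ^ m ≈ 1#
    x^m≈1 {x} x≉0 = begin
      x ^ m                                      ≈⟨ sum-replicate m ⟨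
      sum (replicate m x)                        ≈⟨ sum-cong-≋ (λ i → factor≈x (to-punchIn≉0 i)) ⟨
      sum (removeAt (factor ∘ to) (index 0#))    ≈⟨ *-identityˡ _ ⟨
      1# * sum (removeAt (factor ∘ to) (index 0#)) ≈⟨ *-congʳ (factor≈1 (to-index 0#)) ⟨
      factor (to (index 0#)) * sum (removeAt (factor ∘ to) (index 0#))
                                                 ≈⟨ sum-remove (factor ∘ to) ⟨
      sum (factor ∘ to)                          ≈⟨ *-cancelʳ product≉0 product-scaled ⟩
      1#                                         ∎
      where
      open import Algebra.Properties.CommutativeMonoid.Sum *-commutativeMonoid
      x⁻¹ = proj₁ (inverse x x≉0)
      x⁻¹x : x⁻¹ * x ≈ 1#
      x⁻¹x = trans (*-comm _ _) (proj₂ (inverse x x≉0))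
      open Permuted (x *_) (x⁻¹ *_) *-congˡ *-congˡ
        (λ y → trans (sym (*-assoc _ _ _)) (trans (*-congʳ (proj₂ (inverse x x≉0))) (*-identityˡ y)))
        (λ y → trans (sym (*-assoc _ _ _)) (trans (*-congʳ x⁻¹x) (*-identityˡ y)))

      factor unit : Carrier → Carrier
      factor y with y ≟ 0#
      ... | yes _ = 1#
      ... | no  _ = x
      unit y with y ≟ 0#
      ... | yes _ = 1#
      ... | no  _ = y

      factor≈1 : ∀ {y} → y ≈ 0# → factor y ≈ 1#
      factor≈1 {y} y≈0 with y ≟ 0#
      ... | yes _  = refl
      ... | no y≉0 = ⊥-elim (y≉0 y≈0)

      factor≈x : ∀ {y} → ¬ (y ≈ 0#) → factor y ≈ x
      factor≈x {y} y≉0 with y ≟ 0#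
      ... | yes y≈0 = ⊥-elim (y≉0 y≈0)
      ... | no _    = refl

      unit≉0 : ∀ y → ¬ (unit y ≈ 0#)
      unit≉0 y with y ≟ 0#
      ... | yes _  = 0≉1 ∘ sym
      ... | no y≉0 = y≉0

      unit-cong : ∀ {y z} → y ≈ z → unit y ≈ unit z
      unit-cong {y} {z} y≈z with y ≟ 0# | z ≟ 0#
      ... | yes _   | yes _   = refl
      ... | no _    | no _    = y≈z
      ... | yes y≈0 | no z≉0  = ⊥-elim (z≉0 (trans (sym y≈z) y≈0))
      ... | no y≉0  | yes z≈0 = ⊥-elim (y≉0 (trans y≈z z≈0))

      unit-* : ∀ y → unit (x * y) ≈ factor y * unit y
      unit-* y with y ≟ 0# | x * y ≟ 0#
      ... | yes _   | yes _    = sym (*-identityˡ 1#)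
      ... | no _    | no _     = refl
      ... | yes y≈0 | no xy≉0  = ⊥-elim (xy≉0 (trans (*-congˡ y≈0) (zeroʳ x)))
      ... | no y≉0  | yes xy≈0 = ⊥-elim (*-≉0 x≉0 y≉0 xy≈0)

      to-punchIn≉0 : ∀ i → ¬ (to (Fin.punchIn (index 0#) i) ≈ 0#)
      to-punchIn≉0 i eq = Fin.punchInᵢ≢i (index 0#) i (≡.sym (index-to _ (sym eq)))

      product≉0 : ¬ (sum (unit ∘ to) ≈ 0#)
      product≉0 = sum≉0 (unit ∘ to) (λ i → unit≉0 (to i))
        where
        sum≉0 : ∀ {n} (t : Fin n → Carrier) → (∀ i → ¬ (t i ≈ 0#)) → ¬ (sum t ≈ 0#)
        sum≉0 {zero}  t t≉0 = 0≉1 ∘ sym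
        sum≉0 {suc n} t t≉0 = *-≉0 (t≉0 zero) (sum≉0 (t ∘ suc) (t≉0 ∘ suc))

      product-scaled : sum (factor ∘ to) * sum (unit ∘ to) ≈ 1# * sum (unit ∘ to)
      product-scaled = begin
        sum (factor ∘ to) * sum (unit ∘ to)           ≈⟨ ∑-distrib-+ (factor ∘ to) (unit ∘ to) ⟨
        sum (λ i → factor (to i) * unit (to i))       ≈⟨ sum-cong-≋ (λ i → unit-* (to i)) ⟨
        sum (λ i → unit (x * to i))                   ≈⟨ sum-cong-≋ (λ i → unit-cong (to-index (x * to i))) ⟨
        sum (λ i → unit (to (index (x * to i))))      ≈⟨ sum-permute (unit ∘ to) π ⟨
        sum (unit ∘ to)                               ≈⟨ *-identityˡ _ ⟨
        1# * sum (unit ∘ to)                          ∎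

-- Characteristic and Frobenius map of a field of order p³

module CubicExtension (K : CommutativeRing 0ℓ 0ℓ) (isField : IsField K)
  (p : ℕ) (prime : Prime p) (order : HasOrder K (p ℕ.^ 3)) where
  open CommutativeRing K hiding (zero)
  open IsField isField
  open IntegerCoefficients K
  open FieldProperties K isField
  open import Algebra.Properties.CommutativeSemiring.Exp commutativeSemiring
    using (_^_; ^-congˡ; ^-cong; ^-assocʳ; ^-distrib-*)
  open import Algebra.Properties.Semiring.Mult semiring
    using (×1-homo-*; ×-homo-1; ×-assoc-*; ×-congʳ) renaming (_×_ to _·_)
  open import Algebra.Properties.AbelianGroup +-abelianGroup using (inverseʳ-unique)
  open import Relation.Binary.Reasoning.Setoid setoid

  m : ℕ
  m = ℕ.pred (p ℕ.^ 3)

  p^3≡1+m : p ℕ.^ 3 ≡ suc m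
  p^3≡1+m = ≡.sym (ℕ.suc-pred (p ℕ.^ 3) {{ℕ.m^n≢0 p 3 {{prime⇒nonZero prime}}}})

  open FiniteField m (≡.subst (HasOrder K) p^3≡1+m order) public
    using (_≟_; x^m≈1; order·1≈0)

  -- The cube of p · 1 is p³ · 1 = 0, and a field has no nilpotent elements except 0.
  p·1≈0 : p · 1# ≈ 0#
  p·1≈0 with p · 1# ≟ 0#
  ... | yes eq = eq
  ... | no p≉0 = ⊥-elim (*-≉0 p≉0 (*-≉0 p≉0 (*-≉0 p≉0 1·1≉0)) (begin
    (p · 1#) * ((p · 1#) * ((p · 1#) * (1 · 1#)))  ≈⟨ *-congˡ (*-congˡ (×1-homo-* p 1)) ⟨
    (p · 1#) * ((p · 1#) * ((p ℕ.* 1) · 1#))       ≈⟨ *-congˡ (×1-homo-* p (p ℕ.* 1)) ⟨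
    (p · 1#) * ((p ℕ.* (p ℕ.* 1)) · 1#)            ≈⟨ ×1-homo-* p _ ⟨
    (p ℕ.^ 3) · 1#                                 ≡⟨ ≡.cong (_· 1#) p^3≡1+m ⟩
    suc m · 1#                                     ≈⟨ order·1≈0 ⟩
    0#                                             ∎))
    where
    1·1≉0 : ¬ (1 · 1# ≈ 0#)
    1·1≉0 eq = 0≉1 (sym (trans (sym (×-homo-1 1#)) eq))

  [a*b]·1≈0 : ∀ a {b} → b · 1# ≈ 0# → (a ℕ.* b) · 1# ≈ 0#
  [a*b]·1≈0 a {b} b·1≈0 = trans (×1-homo-* a b) (trans (*-congˡ b·1≈0) (zeroʳ _))

  -- A Bézout relation between k and p would turn k · 1 = 0 and p · 1 = 0 into 1 = 0.
  k·1≉0 : ∀ {k} → 0 < k → k < p → ¬ (k · 1# ≈ 0#)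
  k·1≉0 {suc k} _ k<p k·1≈0 with coprime-Bézout (prime⇒coprime prime k<p)
  ... | Bézout.+- x y eq = 0≉1 (sym (begin
    1#                                ≈⟨ +-identityʳ 1# ⟨
    1# + 0#                           ≈⟨ +-congˡ ([a*b]·1≈0 y k·1≈0) ⟨
    (1 ℕ.+ y ℕ.* suc k) · 1#          ≡⟨ ≡.cong (_· 1#) eq ⟩
    (x ℕ.* p) · 1#                    ≈⟨ [a*b]·1≈0 x p·1≈0 ⟩
    0#                                ∎))
  ... | Bézout.-+ x y eq = 0≉1 (sym (begin
    1#                                ≈⟨ +-identityʳ 1# ⟨
    1# + 0#                           ≈⟨ +-congˡ ([a*b]·1≈0 x p·1≈0) ⟨
    (1 ℕ.+ x ℕ.* p) · 1#              ≡⟨ ≡.cong (_· 1#) eq ⟩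
    (y ℕ.* suc k) · 1#                ≈⟨ [a*b]·1≈0 y k·1≈0 ⟩
    0#                                ∎))

  ⟦⟧≉0 : ∀ i → 0 < ℤ.∣ i ∣ → ℤ.∣ i ∣ < p → ¬ (⟦ i ⟧ ≈ 0#)
  ⟦⟧≉0 (+ n)    0<n n<p = k·1≉0 0<n n<p
  ⟦⟧≉0 -[1+ n ] 0<n n<p eq = k·1≉0 0<n n<p (begin
    suc n · 1#        ≈⟨ ⟦⟧-neg -[1+ n ] ⟩
    - ⟦ -[1+ n ] ⟧    ≈⟨ -‿cong eq ⟩
    - 0#              ≈⟨ ⟦⟧-neg (+ 0) ⟨
    0#                ∎)

  φ : Carrier → Carrier
  φ x = x ^ p

  φ-cong : ∀ {x y} → x ≈ y → φ x ≈ φ y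
  φ-cong = ^-congˡ p

  φ-* : ∀ x y → φ (x * y) ≈ φ x * φ y
  φ-* x y = ^-distrib-* x y p

  φ-0 : φ 0# ≈ 0#
  φ-0 = 0^n p prime
    where
    0^n : ∀ n → Prime n → 0# ^ n ≈ 0#
    0^n zero    pr = ⊥-elim (¬prime[0] pr)
    0^n (suc n) pr = zeroˡ _

  φ-1 : φ 1# ≈ 1#
  φ-1 = 1^n p
    where
    1^n : ∀ n → 1# ^ n ≈ 1#
    1^n zero    = refl
    1^n (suc n) = trans (*-identityˡ _) (1^n n)

  -- In the binomial expansion all terms but the two outer ones are multiples of p.
  φ-+ : ∀ x y → φ (x + y) ≈ φ x + φ y
  φ-+ x y = freshman p prime p·1≈0
    where
    open import Algebra.Properties.CommutativeSemiring.Binomial commutativeSemiring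
      using (theorem; binomial; binomialTerm)
    open import Algebra.Properties.CommutativeMonoid.Sum +-commutativeMonoid
      using (sum; sum-init-last; sum-cong-≋; sum-replicate-zero)

    -- Stated for a fresh p, because the p of the module is a parameter and cannot be matched
    -- against `suc n`.
    freshman : ∀ p → Prime p → p · 1# ≈ 0# → (x + y) ^ p ≈ x ^ p + y ^ p
    freshman zero pr _ = ⊥-elim (¬prime[0] pr)
    freshman p@(suc n) pr p·1≈0 = begin
      (x + y) ^ p                             ≈⟨ theorem p x y ⟩
      sum (term p)                            ≡⟨⟩
      term p zero + sum (term p ∘ suc)        ≈⟨ +-cong first (sum-init-last (term p ∘ suc)) ⟩
      y ^ p + (sum (term p ∘ suc ∘ Fin.inject₁) + term p (fromℕ p))
                                              ≈⟨ +-congˡ (+-cong (trans (sum-cong-≋ middle) (sum-replicate-zero n)) final) ⟩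
      y ^ p + (0# + x ^ p)                    ≈⟨ +-congˡ (+-identityˡ _) ⟩
      y ^ p + x ^ p                           ≈⟨ +-comm _ _ ⟩
      x ^ p + y ^ p                           ∎
      where
      term : ∀ n → Fin (suc n) → Carrier
      term = binomialTerm x y

      first : term p zero ≈ y ^ p
      first = trans (×-homo-1 _) (*-identityˡ _)

      final : term p (fromℕ p) ≈ x ^ p
      final rewrite Fin.toℕ-fromℕ n | nCn≡1 p | ℕ.n∸n≡0 n =
        trans (×-homo-1 _) (*-identityʳ _)

      middle : ∀ i → term p (suc (Fin.inject₁ i)) ≈ 0#
      middle i with prime∣C pr (suc (toℕ (Fin.inject₁ i))) (s≤s z≤n)
        (s≤s (≡.subst (_< n) (≡.sym (Fin.toℕ-inject₁ i)) (Fin.toℕ<n i)))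
      ... | divides q eq = begin
        (p C suc k) · b               ≡⟨ ≡.cong (_· b) eq ⟩
        (q ℕ.* p) · b                 ≈⟨ ×-congʳ (q ℕ.* p) (*-identityˡ b) ⟨
        (q ℕ.* p) · (1# * b)          ≈⟨ ×-assoc-* (q ℕ.* p) 1# b ⟨
        ((q ℕ.* p) · 1#) * b          ≈⟨ *-congʳ (×1-homo-* q p) ⟩
        (q · 1#) * (p · 1#) * b       ≈⟨ *-congʳ (trans (*-congˡ p·1≈0) (zeroʳ _)) ⟩
        0# * b                        ≈⟨ zeroˡ b ⟩
        0#                            ∎
        where
        k = toℕ (Fin.inject₁ i)
        b = binomial x y p (suc (Fin.inject₁ i))

  φ-neg : ∀ x → φ (- x) ≈ - φ x
  φ-neg x = inverseʳ-unique (φ x) (φ (- x)) (begin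
    φ x + φ (- x)   ≈⟨ φ-+ x (- x) ⟨
    φ (x - x)       ≈⟨ φ-cong (-‿inverseʳ x) ⟩
    φ 0#            ≈⟨ φ-0 ⟩
    0#              ∎)

  φ-⟦⟧ : ∀ i → φ ⟦ i ⟧ ≈ ⟦ i ⟧
  φ-⟦⟧ (+ n)    = φ-· n
    where
    φ-· : ∀ n → φ (n · 1#) ≈ n · 1#
    φ-· zero    = φ-0
    φ-· (suc n) = trans (φ-+ _ _) (+-cong φ-1 (φ-· n))
  φ-⟦⟧ -[1+ n ] = trans (φ-neg _) (-‿cong (φ-⟦⟧ (+ suc n)))

  φ-≉0 : ∀ {x} → ¬ (x ≈ 0#) → ¬ (φ x ≈ 0#)
  φ-≉0 = ^-≉0 p

  -- The exponent is p³ = 1 + m, and x ^ m = 1 unless x = 0.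
  φ³ : ∀ x → φ (φ (φ x)) ≈ x
  φ³ x = begin
    φ (φ (φ x))          ≈⟨ φ-cong (^-assocʳ x p p) ⟩
    φ (x ^ (p ℕ.* p))    ≈⟨ ^-assocʳ x (p ℕ.* p) p ⟩
    x ^ (p ℕ.* p ℕ.* p)  ≈⟨ ^-cong {x} refl (≡.trans (cube p) p^3≡1+m) ⟩
    x * x ^ m            ≈⟨ last (x ≟ 0#) ⟩
    x                    ∎
    where
    cube : ∀ p → p ℕ.* p ℕ.* p ≡ p ℕ.* (p ℕ.* (p ℕ.* 1))
    cube = ℕSolver.solve-∀
    last : Dec (x ≈ 0#) → x * x ^ m ≈ x
    last (yes x≈0) = trans (*-congʳ x≈0) (trans (zeroˡ _) (sym x≈0))
    last (no x≉0)  = trans (*-congˡ (x^m≈1 x≉0)) (*-identityʳ x)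

-- A monic polynomial of degree n has at most n roots

module RootBound (K : CommutativeRing 0ℓ 0ℓ) (isField : IsField K) where
  open CommutativeRing K hiding (zero)
  open IsField isField
  open IntegerCoefficients K
  open FieldProperties K isField

  -- monic (c₀ ∷ … ∷ cₙ₋₁) x = c₀ + c₁ x + … + cₙ₋₁ xⁿ⁻¹ + xⁿ
  monic : ∀ {n} → Vec Carrier n → Carrier → Carrier
  monic []       x = ⟦ + 1 ⟧
  monic (c ∷ cs) x = c + x * monic cs x

  -- Horner's scheme: the coefficients of the quotient by x - r are the intermediate values of the
  -- evaluation at r.
  quotient : ∀ {n} → Carrier → Vec Carrier (suc n) → Vec Carrier n
  quotient r (c ∷ [])         = []
  quotient r (c ∷ cs@(_ ∷ _)) = monic cs r ∷ quotient r cs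

  monic-divide : ∀ {n} r x (cs : Vec Carrier (suc n)) →
    monic cs x ≈ monic cs r + (x - r) * monic (quotient r cs) x
  monic-divide r x (c ∷ []) =
    solve 3 (λ c r x → c :+ x :* con (+ 1) := c :+ r :* con (+ 1) :+ (x :- r) :* con (+ 1)) refl c r x
  monic-divide r x (c ∷ cs@(_ ∷ _)) = trans (+-congˡ (*-congˡ (monic-divide r x cs)))
    (solve 5 (λ c r x e q → c :+ x :* (e :+ (x :- r) :* q)
                         := c :+ r :* e :+ (x :- r) :* (e :+ x :* q))
      refl c r x (monic cs r) (monic (quotient r cs) x))

  -- Dividing by x - r for the first root r lowers the degree by one and keeps the remaining roots,
  -- as they differ from r.
  monic-roots : ∀ {n} (cs : Vec Carrier n) (r : Fin (suc n) → Carrier) →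
    (∀ {i j} → r i ≈ r j → i ≡ j) → (∀ i → monic cs (r i) ≈ 0#) → ⊥
  monic-roots [] r _ root = 0≉1 (sym (trans (sym (+-identityʳ 1#)) (root zero)))
  monic-roots cs@(_ ∷ _) r distinct root =
    monic-roots (quotient (r zero) cs) (r ∘ suc) (Fin.suc-injective ∘ distinct) λ i →
      x*y≈0⇒y≈0 (λ eq → Fin.0≢1+n (distinct (sym (x-y≈0⇒x≈y eq))))
        (trans (trans (sym (+-identityˡ _)) (+-congʳ (sym (root zero))))
          (trans (sym (monic-divide (r zero) (r (suc i)) cs)) (root (suc i))))

-- The norm to the field of order p

module NormProperties (K : CommutativeRing 0ℓ 0ℓ) (isField : IsField K)
  (p : ℕ) (prime : Prime p) (order : HasOrder K (p ℕ.^ 3)) where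
  open CommutativeRing K hiding (zero)
  open IntegerCoefficients K
  open FieldProperties K isField
  open CubicExtension K isField p prime order
  open NormGraph K p 4
  open import Algebra.Properties.CommutativeSemiring.Exp commutativeSemiring
    using (_^_; ^-homo-*; ^-assocʳ)
  open import Relation.Binary.Reasoning.Setoid setoid

  pow≈^ : ∀ x n → pow x n ≈ x ^ n
  pow≈^ x zero    = refl
  pow≈^ x (suc n) = *-congˡ (pow≈^ x n)

  norm-expand : ∀ x → norm x ≈ φ (φ x) * (φ x * x)
  norm-expand x = begin
    pow x (normExp 3)                       ≈⟨ pow≈^ x (normExp 3) ⟩
    x ^ (p ℕ.* (p ℕ.* 1) ℕ.+ (p ℕ.* 1 ℕ.+ 1)) ≡⟨ ≡.cong (x ^_) (exponent p) ⟩
    x ^ (p ℕ.* p ℕ.+ (p ℕ.+ 1))             ≈⟨ ^-homo-* x (p ℕ.* p) (p ℕ.+ 1) ⟩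
    x ^ (p ℕ.* p) * x ^ (p ℕ.+ 1)           ≈⟨ *-cong (sym (^-assocʳ x p p)) (^-homo-* x p 1) ⟩
    φ (φ x) * (φ x * (x * 1#))              ≈⟨ *-congˡ (*-congˡ (*-identityʳ x)) ⟩
    φ (φ x) * (φ x * x)                     ∎
    where
    exponent : ∀ p → p ℕ.* (p ℕ.* 1) ℕ.+ (p ℕ.* 1 ℕ.+ 1) ≡ p ℕ.* p ℕ.+ (p ℕ.+ 1)
    exponent = ℕSolver.solve-∀

  norm-cong : ∀ {x y} → x ≈ y → norm x ≈ norm y
  norm-cong {x} {y} x≈y = trans (norm-expand x)
    (trans (*-cong (φ-cong (φ-cong x≈y)) (*-cong (φ-cong x≈y) x≈y)) (sym (norm-expand y)))

  norm-* : ∀ x y → norm (x * y) ≈ norm x * norm y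
  norm-* x y = begin
    norm (x * y)                                     ≈⟨ norm-expand _ ⟩
    φ (φ (x * y)) * (φ (x * y) * (x * y))            ≈⟨ *-cong (φ-cong (φ-* x y)) (*-congʳ (φ-* x y)) ⟩
    φ (φ x * φ y) * (φ x * φ y * (x * y))            ≈⟨ *-congʳ (φ-* _ _) ⟩
    φ (φ x) * φ (φ y) * (φ x * φ y * (x * y))
      ≈⟨ solve 6 (λ a b c d e f → a :* b :* (c :* d :* (e :* f)) := a :* (c :* e) :* (b :* (d :* f))) refl _ _ _ _ _ _ ⟩
    φ (φ x) * (φ x * x) * (φ (φ y) * (φ y * y))      ≈⟨ *-cong (norm-expand x) (norm-expand y) ⟨
    norm x * norm y                                  ∎

  norm-φ : ∀ x → norm (φ x) ≈ norm x
  norm-φ x = begin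
    norm (φ x)                          ≈⟨ norm-expand _ ⟩
    φ (φ (φ x)) * (φ (φ x) * φ x)       ≈⟨ *-congʳ (φ³ x) ⟩
    x * (φ (φ x) * φ x)                 ≈⟨ solve 3 (λ a b c → a :* (b :* c) := b :* (c :* a)) refl _ _ _ ⟩
    φ (φ x) * (φ x * x)                 ≈⟨ norm-expand x ⟨
    norm x                              ∎

  norm-≉0 : ∀ {x} → ¬ (x ≈ 0#) → ¬ (norm x ≈ 0#)
  norm-≉0 {x} x≉0 = ≉0-cong (sym (norm-expand x)) (*-≉0 (φ-≉0 (φ-≉0 x≉0)) (*-≉0 (φ-≉0 x≉0) x≉0))

  -- The norm is fixed by φ, and one factor can be cancelled from (norm x) ^ p = norm x.
  norm-inFqStar : ∀ {x} → ¬ (x ≈ 0#) → InFqStar (norm x)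
  norm-inFqStar {x} x≉0 = norm-≉0 x≉0 , *-cancelˡ {norm x} (norm-≉0 x≉0) (begin
    norm x * pow (norm x) (p ∸ 1)       ≈⟨ *-congˡ (pow≈^ _ (p ∸ 1)) ⟩
    norm x * norm x ^ (p ∸ 1)           ≈⟨ fixed p prime ⟩
    φ (norm x)                          ≈⟨ φ-norm ⟩
    norm x                              ≈⟨ *-identityʳ _ ⟨
    norm x * 1#                         ∎)
    where
    fixed : ∀ n → Prime n → norm x * norm x ^ (n ∸ 1) ≈ norm x ^ n
    fixed zero    pr = ⊥-elim (¬prime[0] pr)
    fixed (suc n) pr = refl
    φ-norm : φ (norm x) ≈ norm x
    φ-norm = begin
      φ (norm x)                                ≈⟨ φ-cong (norm-expand x) ⟩
      φ (φ (φ x) * (φ x * x))                   ≈⟨ trans (φ-* _ _) (*-congˡ (φ-* _ _)) ⟩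
      φ (φ (φ x)) * (φ (φ x) * φ x)             ≈⟨ norm-expand (φ x) ⟨
      norm (φ x)                                ≈⟨ norm-φ x ⟩
      norm x                                    ∎

  -- Elements fixed by φ are roots of X ^ p - X, whose degree p is less than the order p³ of K.
  not-fixed : ∃ λ z → ¬ (φ z ≈ z)
  not-fixed with Fin.any? (λ i → Dec.¬? (φ (to i) ≟ to i))
    where
    open Bijection order using (to)
    import Relation.Nullary.Decidable as Dec
  ... | yes (i , φz≉z) = Bijection.to order i , φz≉z
  ... | no all-fixed = ⊥-elim (too-many p prime p<p^3 λ x → refl)
    where
    open Bijection order using (to; injective)
    open RootBound K isField

    p<p^3 : p < p ℕ.^ 3
    p<p^3 = ≡.subst (_< p ℕ.^ 3) (ℕ.*-identityʳ p)
      (ℕ.^-monoʳ-< p (ℕ.nonTrivial⇒n>1 p {{prime⇒nonTrivial prime}}) {1} {3} (s≤s (s≤s z≤n)))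

    fixed : ∀ i → φ (to i) ≈ to i
    fixed i with φ (to i) ≟ to i
    ... | yes eq = eq
    ... | no ne  = ⊥-elim (all-fixed (i , ne))

    monic-power : ∀ n x → monic (Vec.replicate n ⟦ + 0 ⟧) x ≈ x ^ n
    monic-power zero    x = +-identityʳ 1#
    monic-power (suc n) x = trans (+-identityˡ _) (*-congˡ (monic-power n x))

    -- Here `n` stands for p, exposed as k + 2; the coefficients 0, -1, 0, ..., 0 below are those of
    -- X ^ n - X.
    too-many : ∀ n → Prime n → n < p ℕ.^ 3 → (∀ x → x ^ n ≈ φ x) → ⊥
    too-many zero pr = ⊥-elim (¬prime[0] pr)
    too-many (suc zero) pr = ⊥-elim (¬prime[1] pr)
    too-many (suc (suc k)) pr n<p^3 ^n = monic-roots
      (⟦ + 0 ⟧ ∷ - ⟦ + 1 ⟧ ∷ Vec.replicate k ⟦ + 0 ⟧) (λ i → to (Fin.inject≤ i n<p^3))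
      (Fin.inject≤-injective n<p^3 n<p^3 _ _ ∘ injective)
      (λ i → root (to (Fin.inject≤ i n<p^3)) (fixed _))
      where
      root : ∀ x → φ x ≈ x → monic (⟦ + 0 ⟧ ∷ - ⟦ + 1 ⟧ ∷ Vec.replicate k ⟦ + 0 ⟧) x ≈ 0#
      root x φx≈x = begin
        ⟦ + 0 ⟧ + x * (- ⟦ + 1 ⟧ + x * monic (Vec.replicate k ⟦ + 0 ⟧) x)
          ≈⟨ +-congˡ (*-congˡ (+-congˡ (*-congˡ (monic-power k x)))) ⟩
        ⟦ + 0 ⟧ + x * (- ⟦ + 1 ⟧ + x * x ^ k)
          ≈⟨ solve 2 (λ x y → con (+ 0) :+ x :* (:- con (+ 1) :+ x :* y) := x :* (x :* y) :- x) refl x (x ^ k) ⟩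
        x * (x * x ^ k) - x
          ≈⟨ x≈y⇒x-y≈0 (trans (^n x) φx≈x) ⟩
        0# ∎

-- The six points and the four points

module ShanksElement (K : CommutativeRing 0ℓ 0ℓ) (isField : IsField K)
  (p : ℕ) (prime : Prime p) (order : HasOrder K (p ℕ.^ 3)) (200<p : 200 < p) where
  open CommutativeRing K hiding (zero)
  open IsField isField
  open IntegerCoefficients K
  open FieldProperties K isField
  open CubicExtension K isField p prime order
  open NormProperties K isField p prime order
  open import Relation.Binary.Reasoning.Setoid setoid

  𝟙 : Carrier
  𝟙 = ⟦ + 1 ⟧

  -- The largest integer that has to be nonzero in K is 171, the `discrepancy` of 3 and -6 below;
  -- 200 is a round bound above it.
  small≉0 : ∀ i → 0 < ℤ.∣ i ∣ → ℤ.∣ i ∣ ≤ 200 → ¬ (⟦ i ⟧ ≈ 0#)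
  small≉0 i 0<i i≤200 = ⟦⟧≉0 i 0<i (ℕ.≤-<-trans i≤200 200<p)

  literal≉0 : ∀ i {_ : True (0 ℕ.<? ℤ.∣ i ∣)} {_ : True (ℤ.∣ i ∣ ℕ.≤? 200)} → ¬ (⟦ i ⟧ ≈ 0#)
  literal≉0 i {l} {u} = small≉0 i (toWitness l) (toWitness u)

  divide : ∀ n {d} → ¬ (d ≈ 0#) → ∃ λ x → x * d ≈ n
  divide n {d} d≉0 with inverse d d≉0
  ... | d⁻¹ , dd⁻¹ = n * d⁻¹ , (begin
    n * d⁻¹ * d     ≈⟨ *-assoc _ _ _ ⟩
    n * (d⁻¹ * d)   ≈⟨ *-congˡ (trans (*-comm _ _) dd⁻¹) ⟩
    n * 1#          ≈⟨ *-identityʳ n ⟩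
    n               ∎)

  -- φ acts on x as the Möbius transformation x ↦ -1/(1 + x) of order 3; then x is a root of one of
  -- Shanks' simplest cubics.
  Rotated : Carrier → Set
  Rotated x = φ x * (𝟙 + x) ≈ - 𝟙

  -- Its zeros are the fixed points of the rotation x ↦ -1/(1 + x), the primitive cube roots of
  -- unity; there x and (x - 1)/(x + 2) coincide.
  hexagonal : Carrier → Carrier
  hexagonal x = x * x + x + 𝟙

  -- For `Rotated x` the parameter a with root x is the trace x + φ x + φ² x.
  shanks : Carrier → Carrier → Carrier
  shanks a x = x * x * x - a * (x * x) - (a + ⟦ + 3 ⟧) * x - 𝟙

  rotated-fraction : ∀ {x n d n' d'} → ¬ (d ≈ 0#) → x * d ≈ n → φ n ≈ n' → φ d ≈ d' →
    n' * (d + n) ≈ - (d' * d) → Rotated x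
  rotated-fraction {x} {n} {d} {n'} {d'} d≉0 xd≈n φn φd eq =
    *-cancelʳ (*-≉0 (≉0-cong φd (φ-≉0 d≉0)) d≉0) (begin
      φ x * (𝟙 + x) * (d' * d)
        ≈⟨ solve 4 (λ x y d e → y :* (con (+ 1) :+ x) :* (e :* d) := y :* e :* (d :+ x :* d)) refl x (φ x) d d' ⟩
      φ x * d' * (d + x * d)
        ≈⟨ *-cong (trans (*-congˡ (sym φd)) (trans (sym (φ-* x d)) (trans (φ-cong xd≈n) φn))) (+-congˡ xd≈n) ⟩
      n' * (d + n)             ≈⟨ eq ⟩
      - (d' * d)               ≈⟨ solve 1 (λ x → :- x := :- con (+ 1) :* x) refl (d' * d) ⟩
      - 𝟙 * (d' * d)           ∎)

  hexagonal-fraction : ∀ {x n d} → x * d ≈ n → ¬ (n * n + n * d + d * d ≈ 0#) → ¬ (hexagonal x ≈ 0#)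
  hexagonal-fraction {x} {n} {d} xd≈n ≉0 eq = ≉0 (begin
    n * n + n * d + d * d                      ≈⟨ +-congʳ (+-cong (*-cong xd≈n xd≈n) (*-congʳ xd≈n)) ⟨
    x * d * (x * d) + x * d * d + d * d
      ≈⟨ solve 2 (λ x d → x :* d :* (x :* d) :+ x :* d :* d :+ d :* d := (x :* x :+ x :+ con (+ 1)) :* (d :* d)) refl x d ⟩
    hexagonal x * (d * d)                      ≈⟨ *-congʳ eq ⟩
    0# * (d * d)                               ≈⟨ zeroˡ _ ⟩
    0#                                         ∎)

  φ-sub : ∀ x y → φ (x - y) ≈ φ x - φ y
  φ-sub x y = trans (φ-+ _ _) (+-congˡ (φ-neg y))

  vanish : ∀ {x y z} → x ≈ z * y → y ≈ 0# → x ≈ 0#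
  vanish x≈zy y≈0 = trans x≈zy (trans (*-congˡ y≈0) (zeroʳ _))

  -- Here ω = -1 - x is a primitive cube root of unity in the base field and φ y ≈ ω y; the witness is
  -- (x + (1 + x) y)/(1 - y).
  rotated-from-eigenvector : ∀ {x y} → hexagonal x ≈ 0# → φ x ≈ x → φ y ≈ - (𝟙 + x) * y →
    ¬ (y ≈ 0#) → ∃ λ x' → Rotated x' × ¬ (hexagonal x' ≈ 0#)
  rotated-from-eigenvector {x} {y} hex φx φy y≉0 =
    x' , rotated-fraction d≉0 x'd≈n φn φd rotation , hexagonal-fraction x'd≈n hex≉0
    where
    -- The fraction x' = n / d solves (x' - ω²)/(x' - ω) = y. In this coordinate the rotation is
    -- multiplication by ω, which is how φ acts on y.
    n = x + (𝟙 + x) * y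
    d = 𝟙 - y
    φ[1+x] : φ (𝟙 + x) ≈ 𝟙 + x
    φ[1+x] = trans (φ-+ _ _) (+-cong (φ-⟦⟧ (+ 1)) φx)
    φn : φ n ≈ x + (𝟙 + x) * (- (𝟙 + x) * y)
    φn = trans (φ-+ _ _) (+-cong φx (trans (φ-* _ _) (*-cong φ[1+x] φy)))
    φd : φ d ≈ 𝟙 - - (𝟙 + x) * y
    φd = trans (φ-sub _ _) (+-cong (φ-⟦⟧ (+ 1)) (-‿cong φy))
    -- If y = 1, then φ y = y forces x = -2, where `hexagonal` has the value 3.
    d≉0 : ¬ (d ≈ 0#)
    d≉0 d≈0 = literal≉0 (+ 3) (begin
      ⟦ + 3 ⟧
        ≈⟨ solve 2 (λ x y → con (+ 3) := x :* x :+ x :+ con (+ 1)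
             :- (con (+ 1) :- :- (con (+ 1) :+ x) :* y :+ (con (+ 1) :+ x) :* (con (+ 1) :- y)) :* (x :- con (+ 1))) refl x y ⟩
      hexagonal x - (𝟙 - - (𝟙 + x) * y + (𝟙 + x) * d) * (x - 𝟙)
        ≈⟨ +-cong hex (-‿cong (*-congʳ (+-cong (trans (sym φd) (trans (φ-cong d≈0) φ-0)) (*-congˡ d≈0)))) ⟩
      0# - (0# + (𝟙 + x) * 0#) * (x - 𝟙)
        ≈⟨ solve 1 (λ x → con (+ 0) :- (con (+ 0) :+ (con (+ 1) :+ x) :* con (+ 0)) :* (x :- con (+ 1)) := con (+ 0)) refl x ⟩
      0# ∎)
    x' = proj₁ (divide n d≉0)
    x'd≈n : x' * d ≈ n
    x'd≈n = proj₂ (divide n d≉0)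
    rotation : (x + (𝟙 + x) * (- (𝟙 + x) * y)) * (d + n) ≈ - ((𝟙 - - (𝟙 + x) * y) * d)
    rotation = x-y≈0⇒x≈y (vanish
      (solve 2 (λ x y → (x :+ (con (+ 1) :+ x) :* (:- (con (+ 1) :+ x) :* y)) :* (con (+ 1) :- y :+ (x :+ (con (+ 1) :+ x) :* y))
          :- :- ((con (+ 1) :- :- (con (+ 1) :+ x) :* y) :* (con (+ 1) :- y))
        := (con (+ 1) :- (con (+ 1) :+ x) :* y :- (con (+ 1) :+ x) :* (y :* y)) :* (x :* x :+ x :+ con (+ 1))) refl x y)
      hex)
    hex≉0 : ¬ (n * n + n * d + d * d ≈ 0#)
    hex≉0 eq = *-≉0 (literal≉0 (+ 3)) y≉0 (begin
      ⟦ + 3 ⟧ * y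
        ≈⟨ solve 2 (λ x y → con (+ 3) :* y := (con (+ 1) :+ con (+ 2) :* y :+ y :* y) :* (x :* x :+ x :+ con (+ 1))
             :- ((x :+ (con (+ 1) :+ x) :* y) :* (x :+ (con (+ 1) :+ x) :* y)
                 :+ (x :+ (con (+ 1) :+ x) :* y) :* (con (+ 1) :- y) :+ (con (+ 1) :- y) :* (con (+ 1) :- y))) refl x y ⟩
      (𝟙 + ⟦ + 2 ⟧ * y + y * y) * hexagonal x - (n * n + n * d + d * d)
        ≈⟨ +-cong (trans (*-congˡ hex) (zeroʳ _)) (-‿cong eq) ⟩
      0# - 0#  ≈⟨ -‿inverseʳ 0# ⟩
      0#       ∎)

  -- The conjugates a, b, c of a = z - φ z add up to 0. Hence x = a / b has 1 + x = -c / b and φ x =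
  -- b / c.
  exists-rotated : ∃ λ x → Rotated x × ¬ (hexagonal x ≈ 0#)
  exists-rotated with not-fixed
  ... | z , φz≉z = choose (hexagonal x ≟ 0#)
    where
    a = z - φ z
    b = φ z - φ (φ z)
    c = φ (φ z) - z
    φa : φ a ≈ b
    φa = φ-sub _ _
    φb : φ b ≈ c
    φb = trans (φ-sub _ _) (+-congˡ (-‿cong (φ³ z)))
    a≉0 : ¬ (a ≈ 0#)
    a≉0 eq = φz≉z (sym (x-y≈0⇒x≈y eq))
    b≉0 : ¬ (b ≈ 0#)
    b≉0 = ≉0-cong φa (φ-≉0 a≉0)
    x = proj₁ (divide a b≉0)
    xb≈a : x * b ≈ a
    xb≈a = proj₂ (divide a b≉0)
    rotated : Rotated x
    rotated = rotated-fraction b≉0 xb≈a φa φb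
      (solve 3 (λ z u v → (u :- v) :* (u :- v :+ (z :- u)) := :- ((v :- z) :* (u :- v))) refl z (φ z) (φ (φ z)))
    choose : Dec (hexagonal x ≈ 0#) → ∃ λ x → Rotated x × ¬ (hexagonal x ≈ 0#)
    choose (no ≉0)   = x , rotated , ≉0
    -- A fixed point x of the rotation is fixed by φ, and a = x b with x² + x + 1 = 0 gives φ a = b
    -- = -(1 + x) a: an eigenvector.
    choose (yes hex) = rotated-from-eigenvector hex φx φa' a≉0
      where
      φx : φ x ≈ x
      φx = *-cancelʳ {𝟙 + x} 1+x≉0 (trans rotated (sym x[1+x]≈-1))
        where
        x[1+x]≈-1 : x * (𝟙 + x) ≈ - 𝟙
        x[1+x]≈-1 = x-y≈0⇒x≈y (trans
          (solve 1 (λ x → x :* (con (+ 1) :+ x) :- :- con (+ 1) := x :* x :+ x :+ con (+ 1)) refl x) hex)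
        1+x≉0 : ¬ (𝟙 + x ≈ 0#)
        1+x≉0 eq = literal≉0 -[1+ 0 ] (trans (sym rotated) (trans (*-congˡ eq) (zeroʳ _)))
      φa' : φ a ≈ - (𝟙 + x) * a
      φa' = begin
        φ a                              ≈⟨ φa ⟩
        b                                ≈⟨ solve 2 (λ x b → b := b :* (x :* x :+ x :+ con (+ 1)) :- (con (+ 1) :+ x) :* (x :* b)) refl x b ⟩
        b * hexagonal x - (𝟙 + x) * (x * b) ≈⟨ +-cong (trans (*-congˡ hex) (zeroʳ b)) (-‿cong (*-congˡ xb≈a)) ⟩
        0# - (𝟙 + x) * a                 ≈⟨ solve 2 (λ x a → con (+ 0) :- (con (+ 1) :+ x) :* a := :- (con (+ 1) :+ x) :* a) refl x a ⟩
        - (𝟙 + x) * a                    ∎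

  -- As φ fixes integers, x = c would imply c (1 + c) + 1 = 0 in K.
  rotated≉literal : ∀ {x} → Rotated x → ∀ c → let i = c ℤ.* (+ 1 ℤ.+ c) ℤ.+ + 1 in
    {_ : True (0 ℕ.<? ℤ.∣ i ∣)} {_ : True (ℤ.∣ i ∣ ℕ.≤? 200)} → ¬ (x ≈ ⟦ c ⟧)
  rotated≉literal {x} rotated c {l} {u} x≈c = literal≉0 (c ℤ.* (+ 1 ℤ.+ c) ℤ.+ + 1) {l} {u} (begin
    ⟦ c ℤ.* (+ 1 ℤ.+ c) ℤ.+ + 1 ⟧   ≈⟨ trans (⟦⟧-+ (c ℤ.* (+ 1 ℤ.+ c)) (+ 1)) (+-congʳ (trans (⟦⟧-* c (+ 1 ℤ.+ c)) (*-congˡ (⟦⟧-+ (+ 1) c)))) ⟩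
    ⟦ c ⟧ * (𝟙 + ⟦ c ⟧) + 𝟙         ≈⟨ +-congʳ (*-cong (trans (sym (φ-⟦⟧ c)) (φ-cong (sym x≈c))) (+-congˡ (sym x≈c))) ⟩
    φ x * (𝟙 + x) + 𝟙               ≈⟨ +-congʳ rotated ⟩
    - 𝟙 + 𝟙                         ≈⟨ -‿inverseˡ 𝟙 ⟩
    0#                              ∎)

  1+x≉0 : ∀ {x} → Rotated x → ¬ (𝟙 + x ≈ 0#)
  1+x≉0 rotated eq = literal≉0 -[1+ 0 ] (trans (sym rotated) (trans (*-congˡ eq) (zeroʳ _)))

  x≉0 : ∀ {x} → Rotated x → ¬ (x ≈ 0#)
  x≉0 rotated = rotated≉literal rotated (+ 0)

  +literal≉0 : ∀ {x} → Rotated x → ∀ c → let i = ℤ.- c ℤ.* (+ 1 ℤ.+ ℤ.- c) ℤ.+ + 1 in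
    {_ : True (0 ℕ.<? ℤ.∣ i ∣)} {_ : True (ℤ.∣ i ∣ ℕ.≤? 200)} → ¬ (x + ⟦ c ⟧ ≈ 0#)
  +literal≉0 {x} rotated c {l} {u} eq = rotated≉literal rotated (ℤ.- c) {l} {u} (begin
    x                      ≈⟨ solve 2 (λ x c → x := (x :+ c) :- c) refl x ⟦ c ⟧ ⟩
    (x + ⟦ c ⟧) - ⟦ c ⟧    ≈⟨ +-congʳ eq ⟩
    0# - ⟦ c ⟧             ≈⟨ +-identityˡ _ ⟩
    - ⟦ c ⟧                ≈⟨ ⟦⟧-neg c ⟨
    ⟦ ℤ.- c ⟧              ∎)

  -- For these parameters of Shanks' cubic two of the six points coincide.
  exceptional : Fin 4 → ℤ
  exceptional zero                   = + 0
  exceptional (suc zero)             = + 3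
  exceptional (suc (suc zero))       = ℤ.- + 3
  exceptional (suc (suc (suc zero))) = ℤ.- + 6

  Generic : Carrier → Set
  Generic x = ∀ i → ¬ (shanks ⟦ exceptional i ⟧ x ≈ 0#)

  -- x ↦ (2x - 1)/(x + 3) commutes with the rotation and moves the parameter of Shanks' cubic by a
  -- Möbius transformation that maps no exceptional parameter to an exceptional one.
  module Translate {x y} (y[x+3]≈2x-1 : y * (x + ⟦ + 3 ⟧) ≈ ⟦ + 2 ⟧ * x - 𝟙) where

    -- Encodes a = (54 + 19 b)/(1 - 6 b), the relation between the parameter a of x and the
    -- parameter b of y, without division.
    discrepancy : ℤ → ℤ → ℤ
    discrepancy a b = (+ 1 ℤ.- + 6 ℤ.* b) ℤ.* a ℤ.- (+ 54 ℤ.+ + 19 ℤ.* b)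

    ⟦discrepancy⟧ : ∀ a b → ⟦ discrepancy a b ⟧ ≈
      (𝟙 - ⟦ + 6 ⟧ * ⟦ b ⟧) * ⟦ a ⟧ - (⟦ + 54 ⟧ + ⟦ + 19 ⟧ * ⟦ b ⟧)
    ⟦discrepancy⟧ a b = trans (⟦⟧-+ ((+ 1 ℤ.- + 6 ℤ.* b) ℤ.* a) (ℤ.- (+ 54 ℤ.+ + 19 ℤ.* b))) (+-cong
      (trans (⟦⟧-* (+ 1 ℤ.- + 6 ℤ.* b) a) (*-congʳ (trans (⟦⟧-+ (+ 1) (ℤ.- (+ 6 ℤ.* b)))
        (+-congˡ (trans (⟦⟧-neg (+ 6 ℤ.* b)) (-‿cong (⟦⟧-* (+ 6) b)))))))
      (trans (⟦⟧-neg (+ 54 ℤ.+ + 19 ℤ.* b)) (-‿cong (trans (⟦⟧-+ (+ 54) (+ 19 ℤ.* b)) (+-congˡ (⟦⟧-* (+ 19) b))))))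

    -- Substituting (2x - 1)/(x + 3) into the homogenised cubic with parameter b gives leading
    -- coefficient 1 - 6b and constant term -(1 - 6b). Subtracting 1 - 6b times the cubic of x
    -- therefore leaves a multiple of x (1 + x).
    shanks-translate : ∀ a b → shanks a x ≈ 0# → shanks b y ≈ 0# →
      ((𝟙 - ⟦ + 6 ⟧ * b) * a - (⟦ + 54 ⟧ + ⟦ + 19 ⟧ * b)) * (x * (𝟙 + x)) ≈ 0#
    shanks-translate a b fx fy = begin
      ((𝟙 - ⟦ + 6 ⟧ * b) * a - (⟦ + 54 ⟧ + ⟦ + 19 ⟧ * b)) * (x * (𝟙 + x))
        ≈⟨ solve 3 (λ x a b →
             ((con (+ 1) :- con (+ 6) :* b) :* a :- (con (+ 54) :+ con (+ 19) :* b)) :* (x :* (con (+ 1) :+ x))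
             := homogeneous b (con (+ 2) :* x :- con (+ 1)) (x :+ con (+ 3))
                :- (con (+ 1) :- con (+ 6) :* b) :* homogeneous a x (con (+ 1))) refl x a b ⟩
      shanksH b (⟦ + 2 ⟧ * x - 𝟙) (x + ⟦ + 3 ⟧) - (𝟙 - ⟦ + 6 ⟧ * b) * shanksH a x 𝟙
        ≈⟨ +-cong
             (trans (shanksH-cong b (sym y[x+3]≈2x-1)) (trans
               (solve 3 (λ b y d → homogeneous b (y :* d) d := homogeneous b y (con (+ 1)) :* (d :* d :* d)) refl b y (x + ⟦ + 3 ⟧))
               (trans (*-congʳ (trans (shanksH-1 b y) fy)) (zeroˡ _))))
             (-‿cong (trans (*-congˡ (trans (shanksH-1 a x) fx)) (zeroʳ _))) ⟩
      0# - 0#     ≈⟨ -‿inverseʳ 0# ⟩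
      0#          ∎
      where
      shanksH : Carrier → Carrier → Carrier → Carrier
      shanksH a n d = n * n * n - a * (n * n * d) - (a + ⟦ + 3 ⟧) * (n * d * d) - d * d * d
      homogeneous : ∀ {k} → Polynomial k → Polynomial k → Polynomial k → Polynomial k
      homogeneous a n d = n :* n :* n :- a :* (n :* n :* d) :- (a :+ con (+ 3)) :* (n :* d :* d) :- d :* d :* d
      shanksH-cong : ∀ a {n n' d} → n ≈ n' → shanksH a n d ≈ shanksH a n' d
      shanksH-cong a n≈n' = +-congʳ (+-cong (+-cong (*-cong (*-cong n≈n' n≈n') n≈n')
        (-‿cong (*-congˡ (*-congʳ (*-cong n≈n' n≈n'))))) (-‿cong (*-congˡ (*-congʳ (*-congʳ n≈n')))))
      shanksH-1 : ∀ a x → shanksH a x 𝟙 ≈ shanks a x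
      shanksH-1 = solve 2 (λ a x → homogeneous a x (con (+ 1))
        := x :* x :* x :- a :* (x :* x) :- (a :+ con (+ 3)) :* x :- con (+ 1)) refl

    generic : Rotated x → ∀ i → shanks ⟦ exceptional i ⟧ x ≈ 0# → Generic y
    generic rotated i fx j fy = *-≉0
      (≉0-cong (⟦discrepancy⟧ (exceptional i) (exceptional j))
        (small≉0 (discrepancy (exceptional i) (exceptional j)) (proj₁ (bounds i j)) (proj₂ (bounds i j))))
      (*-≉0 (x≉0 rotated) (1+x≉0 rotated))
      (shanks-translate ⟦ exceptional i ⟧ ⟦ exceptional j ⟧ fx fy)
      where
      bounds : ∀ i j → 0 < ℤ.∣ discrepancy (exceptional i) (exceptional j) ∣ ×
        ℤ.∣ discrepancy (exceptional i) (exceptional j) ∣ ≤ 200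
      bounds = from-yes (Fin.all? λ i → Fin.all? λ j →
        (0 ℕ.<? ℤ.∣ discrepancy (exceptional i) (exceptional j) ∣) ×-dec
        (ℤ.∣ discrepancy (exceptional i) (exceptional j) ∣ ℕ.≤? 200))

  exists-generic : ∃ λ x → Rotated x × ¬ (hexagonal x ≈ 0#) × Generic x
  exists-generic = choose exists-rotated
    where
    choose : (∃ λ x → Rotated x × ¬ (hexagonal x ≈ 0#)) → ∃ λ x → Rotated x × ¬ (hexagonal x ≈ 0#) × Generic x
    choose (x , rotated , hex≉0) with Fin.any? (λ i → shanks ⟦ exceptional i ⟧ x ≟ 0#)
    ... | no ¬bad       = x , rotated , hex≉0 , λ i eq → ¬bad (i , eq)
    ... | yes (i , bad) = y , y-rotated , y-hex≉0 , Translate.generic y-def rotated i bad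
      where
      d≉0 : ¬ (x + ⟦ + 3 ⟧ ≈ 0#)
      d≉0 = +literal≉0 rotated (+ 3)
      y = proj₁ (divide (⟦ + 2 ⟧ * x - 𝟙) d≉0)
      y-def : y * (x + ⟦ + 3 ⟧) ≈ ⟦ + 2 ⟧ * x - 𝟙
      y-def = proj₂ (divide (⟦ + 2 ⟧ * x - 𝟙) d≉0)
      y-rotated : Rotated y
      y-rotated = rotated-fraction d≉0 y-def
        (trans (φ-sub _ _) (+-cong (trans (φ-* _ _) (*-congʳ (φ-⟦⟧ (+ 2)))) (-‿cong (φ-⟦⟧ (+ 1)))))
        (trans (φ-+ _ _) (+-congˡ (φ-⟦⟧ (+ 3))))
        -- The factor 7 = 2 · 3 + 1 is the determinant of x ↦ (2x - 1)/(x + 3).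
        (x-y≈0⇒x≈y (vanish (solve 2 (λ x y →
            (con (+ 2) :* y :- con (+ 1)) :* (x :+ con (+ 3) :+ (con (+ 2) :* x :- con (+ 1)))
              :- :- ((y :+ con (+ 3)) :* (x :+ con (+ 3)))
          := con (+ 7) :* (y :* (con (+ 1) :+ x) :- :- con (+ 1))) refl x (φ x))
          (x≈y⇒x-y≈0 rotated)))
      y-hex≉0 : ¬ (hexagonal y ≈ 0#)
      y-hex≉0 = hexagonal-fraction y-def (≉0-cong
        (solve 1 (λ x → con (+ 7) :* (x :* x :+ x :+ con (+ 1)) :=
          (con (+ 2) :* x :- con (+ 1)) :* (con (+ 2) :* x :- con (+ 1))
            :+ (con (+ 2) :* x :- con (+ 1)) :* (x :+ con (+ 3)) :+ (x :+ con (+ 3)) :* (x :+ con (+ 3))) refl x)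
        (*-≉0 (literal≉0 (+ 7)) hex≉0))

-- The complete bipartite graph obtained from x

module Configuration (K : CommutativeRing 0ℓ 0ℓ) (isField : IsField K)
  (p : ℕ) (prime : Prime p) (order : HasOrder K (p ℕ.^ 3)) (200<p : 200 < p) where
  open CommutativeRing K hiding (zero)
  open IntegerCoefficients K
  open FieldProperties K isField
  open CubicExtension K isField p prime order
  open NormProperties K isField p prime order
  open ShanksElement K isField p prime order 200<p
  open NormGraph K p 4
  open import Algebra.Properties.AbelianGroup +-abelianGroup using () renaming (∙-cancelʳ to +-cancelʳ)
  open import Relation.Binary.Reasoning.Setoid setoid

  -- The translation (α , a) ↦ (α + s , a), (β , b) ↦ (β - s , b) preserves adjacency; each pair
  -- (i , j) rules out at most one s.
  exists-shift : ∀ {m n} (A : Fin m → Carrier) (B : Fin n → Carrier) → m ℕ.* n ≤ 200 →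
    ∃ λ s → ∀ i j → ¬ (A i + s ≈ B j - s)
  exists-shift {m} {n} A B mn≤200 = decide (Fin.any? λ k → ¬? (bad? k))
    where
    -- One shift more than there are pairs, as the pigeonhole argument needs.
    shift : Fin (suc (m ℕ.* n)) → Carrier
    shift k = ⟦ + toℕ k ⟧

    Bad : Fin (suc (m ℕ.* n)) → Set
    Bad k = ∃ λ i → ∃ λ j → A i + shift k ≈ B j - shift k

    bad? : ∀ k → Dec (Bad k)
    bad? k = Fin.any? λ i → Fin.any? λ j → A i + shift k ≟ B j - shift k

    once : ∀ {k l} → k Fin.< l → ∀ i j → A i + shift k ≈ B j - shift k → ¬ (A i + shift l ≈ B j - shift l)
    once {k} {l} k<l i j bad-k bad-l = *-≉0 (literal≉0 (+ 2))
      (small≉0 (toℕ l ℤ.⊖ toℕ k) (≡.subst (0 <_) (≡.sym ∣l-k∣) (ℕ.m<n⇒0<n∸m k<l))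
        (≡.subst (_≤ 200) (≡.sym ∣l-k∣)
          (ℕ.≤-trans (ℕ.m∸n≤m (toℕ l) (toℕ k)) (ℕ.≤-trans (ℕ.s≤s⁻¹ (Fin.toℕ<n l)) mn≤200)))) (begin
      ⟦ + 2 ⟧ * ⟦ toℕ l ℤ.⊖ toℕ k ⟧          ≈⟨ *-congˡ (⟦⟧-⊖ (toℕ l) (toℕ k)) ⟩
      ⟦ + 2 ⟧ * (shift l - shift k)
        ≈⟨ solve 4 (λ a b s t → con (+ 2) :* (t :- s) := (a :+ t :- (b :- t)) :- (a :+ s :- (b :- s))) refl (A i) (B j) (shift k) (shift l) ⟩
      (A i + shift l - (B j - shift l)) - (A i + shift k - (B j - shift k))
        ≈⟨ +-cong (x≈y⇒x-y≈0 bad-l) (-‿cong (x≈y⇒x-y≈0 bad-k)) ⟩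
      0# - 0#                                 ≈⟨ -‿inverseʳ 0# ⟩
      0#                                      ∎)
      where
      ∣l-k∣ : ℤ.∣ toℕ l ℤ.⊖ toℕ k ∣ ≡ toℕ l ∸ toℕ k
      ∣l-k∣ = ≡.cong ℤ.∣_∣ (ℤ.⊖-≥ (ℕ.<⇒≤ k<l))

    collide : ¬ (∀ k → Bad k)
    collide bad with Fin.pigeonhole (ℕ.n<1+n (m ℕ.* n)) (λ k → Fin.combine (proj₁ (bad k)) (proj₁ (proj₂ (bad k))))
    ... | k , l , k<l , eq with bad k | bad l
    ...   | i , j , bad-k | i' , j' , bad-l with Fin.combine-injective i j i' j' eq
    ...     | ≡.refl , ≡.refl = once k<l i j bad-k bad-l

    decide : Dec (∃ λ k → ¬ Bad k) → ∃ λ s → ∀ i j → ¬ (A i + s ≈ B j - s)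
    decide (yes (k , good)) = shift k , λ i j eq → good (i , j , eq)
    decide (no ¬good) = ⊥-elim (collide λ k → decidable-stable (bad? k) λ good → ¬good (k , good))

  -- Names for the factors let one table serve the solver's polynomials, the elements of K and the
  -- bookkeeping of norms. Up to sign and powers of 1 + x, `[x-1]`, `[x+2]`, `[2x+1]` are conjugate,
  -- and so are `[q]`, `[s]`, `[r]`.
  data Factor : Set where
    [-1] [x] [1+x] [x-1] [x+2] [2x+1] [q] [r] [s] : Factor

  factorP : ∀ {k} → Polynomial k → Factor → Polynomial k
  factorP x [-1]  = :- con (+ 1)
  factorP x [x]    = x
  factorP x [1+x]  = con (+ 1) :+ x
  -- Written as x + (-1), and `[q]` below with its leading coefficient 1, so that the values have
  -- the literal shape treated by `φ-linear` and `φ-quadratic`.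
  factorP x [x-1]  = x :+ con -[1+ 0 ]
  factorP x [x+2]  = x :+ con (+ 2)
  factorP x [2x+1] = con (+ 2) :* x :+ con (+ 1)
  factorP x [q]    = con (+ 1) :* (x :* x) :+ con -[1+ 1 ] :* x :+ con -[1+ 1 ]
  factorP x [r]    = con (+ 1) :* (x :* x) :+ con (+ 4) :* x :+ con (+ 1)
  factorP x [s]    = con (+ 2) :* (x :* x) :+ con (+ 2) :* x :+ con -[1+ 0 ]

  productP : ∀ {k} → Polynomial k → List Factor → Polynomial k
  productP x []       = con (+ 1)
  productP x (f ∷ fs) = factorP x f :* productP x fs

  -- u and q stand for x - 1 and x² - 2x - 2.
  representativeP : ∀ {k} → Polynomial k → Polynomial k → Factor → Polynomial k
  representativeP u q [-1]  = :- con (+ 1)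
  representativeP u q [x]    = con (+ 1)
  representativeP u q [1+x]  = :- con (+ 1)
  representativeP u q [x-1]  = u
  representativeP u q [x+2]  = u
  representativeP u q [2x+1] = :- con (+ 1) :* u
  representativeP u q [q]    = q
  representativeP u q [r]    = q
  representativeP u q [s]    = :- con (+ 1) :* q

  representativesP : ∀ {k} → Polynomial k → Polynomial k → List Factor → Polynomial k
  representativesP u q []       = con (+ 1)
  representativesP u q (f ∷ fs) = representativeP u q f :* representativesP u q fs

  -- The six points are num j / den j, with num j and den j given by numF and denF; sumF factors
  -- num j + den j, and gF the product of den j with θ - num j / den j and a denominator of θ.
  numF denF sumF gF : Fin 6 → List Factor
  numF 0F = [x] ∷ []
  numF 1F = [x-1] ∷ []
  numF 2F = [2x+1] ∷ []
  numF 3F = [-1] ∷ [1+x] ∷ []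
  numF 4F = [x+2] ∷ []
  numF 5F = [-1] ∷ [2x+1] ∷ []
  denF 0F = []
  denF 1F = [x+2] ∷ []
  denF 2F = [x-1] ∷ [1+x] ∷ []
  denF 3F = []
  denF 4F = [x-1] ∷ []
  denF 5F = [x] ∷ [x+2] ∷ []
  sumF 0F = [1+x] ∷ []
  sumF 1F = [2x+1] ∷ []
  sumF 2F = [x] ∷ [x+2] ∷ []
  sumF 3F = [-1] ∷ [x] ∷ []
  sumF 4F = [2x+1] ∷ []
  sumF 5F = [x-1] ∷ [1+x] ∷ []
  gF 0F = [-1] ∷ [1+x] ∷ [q] ∷ []
  gF 1F = [x+2] ∷ [r] ∷ []
  gF 2F = [x-1] ∷ [x] ∷ [s] ∷ []
  gF 3F = [x] ∷ [r] ∷ []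
  gF 4F = [x-1] ∷ [q] ∷ []
  gF 5F = [x+2] ∷ [1+x] ∷ [s] ∷ []

  eP : ∀ {k} → Polynomial k → Fin 6 → Polynomial k
  eP x j = productP x (numF j) :- con (+ 2) :* productP x (denF j)

  crossP : ∀ {k} → Polynomial k → Fin 6 → Fin 6 → Polynomial k
  crossP x i j = productP x (numF i) :* productP x (denF j) :- productP x (numF j) :* productP x (denF i)

  hexP : ∀ {k} → Polynomial k → Polynomial k
  hexP x = x :* x :+ x :+ con (+ 1)

  shanksP : ∀ {k} → Polynomial k → ℤ → Polynomial k
  shanksP x a = x :* x :* x :- con a :* (x :* x) :- (con a :+ con (+ 3)) :* x :- con (+ 1)

  module _ {x : Carrier} (rotated : Rotated x) (hex≉0 : ¬ (hexagonal x ≈ 0#)) (generic : Generic x) where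

    value : Factor → Carrier
    value [-1]  = - 𝟙
    value [x]    = x
    value [1+x]  = 𝟙 + x
    value [x-1]  = x + ⟦ -[1+ 0 ] ⟧
    value [x+2]  = x + ⟦ + 2 ⟧
    value [2x+1] = ⟦ + 2 ⟧ * x + 𝟙
    value [q]    = 𝟙 * (x * x) + ⟦ -[1+ 1 ] ⟧ * x + ⟦ -[1+ 1 ] ⟧
    value [r]    = 𝟙 * (x * x) + ⟦ + 4 ⟧ * x + 𝟙
    value [s]    = ⟦ + 2 ⟧ * (x * x) + ⟦ + 2 ⟧ * x + ⟦ -[1+ 0 ] ⟧

    product : List Factor → Carrier
    product []       = 𝟙
    product (f ∷ fs) = value f * product fs

    1+x : Carrier
    1+x = 𝟙 + x

    -- Because φ x = -1/(1 + x), the conjugate of a polynomial of degree d in x becomes a polynomial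
    -- after multiplication by (1 + x)^d; d is 1 here and 2 in `φ-quadratic`.
    φ-linear : ∀ b → φ (x + ⟦ b ⟧) * 1+x ≈ - 𝟙 + ⟦ b ⟧ * 1+x
    φ-linear b = begin
      φ (x + ⟦ b ⟧) * 1+x            ≈⟨ *-congʳ (trans (φ-+ _ _) (+-congˡ (φ-⟦⟧ b))) ⟩
      (φ x + ⟦ b ⟧) * 1+x            ≈⟨ distribʳ _ _ _ ⟩
      φ x * 1+x + ⟦ b ⟧ * 1+x        ≈⟨ +-congʳ rotated ⟩
      - 𝟙 + ⟦ b ⟧ * 1+x              ∎

    φ-quadratic : ∀ a b c → φ (⟦ a ⟧ * (x * x) + ⟦ b ⟧ * x + ⟦ c ⟧) * (1+x * 1+x) ≈
      ⟦ a ⟧ - ⟦ b ⟧ * 1+x + ⟦ c ⟧ * (1+x * 1+x)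
    φ-quadratic a b c = begin
      φ (⟦ a ⟧ * (x * x) + ⟦ b ⟧ * x + ⟦ c ⟧) * (1+x * 1+x)
        ≈⟨ *-congʳ (trans (φ-+ _ _) (+-cong (trans (φ-+ _ _) (+-cong
             (trans (φ-* _ _) (*-cong (φ-⟦⟧ a) (φ-* _ _))) (trans (φ-* _ _) (*-congʳ (φ-⟦⟧ b))))) (φ-⟦⟧ c))) ⟩
      (⟦ a ⟧ * (φ x * φ x) + ⟦ b ⟧ * φ x + ⟦ c ⟧) * (1+x * 1+x)
        ≈⟨ solve 5 (λ a b c y z → (a :* (y :* y) :+ b :* y :+ c) :* (z :* z)
             := a :* (y :* z :* (y :* z)) :+ b :* (y :* z) :* z :+ c :* (z :* z)) refl ⟦ a ⟧ ⟦ b ⟧ ⟦ c ⟧ (φ x) 1+x ⟩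
      ⟦ a ⟧ * (φ x * 1+x * (φ x * 1+x)) + ⟦ b ⟧ * (φ x * 1+x) * 1+x + ⟦ c ⟧ * (1+x * 1+x)
        ≈⟨ +-congʳ (+-cong (*-congˡ (*-cong rotated rotated)) (*-congʳ (*-congˡ rotated))) ⟩
      ⟦ a ⟧ * (- 𝟙 * - 𝟙) + ⟦ b ⟧ * - 𝟙 * 1+x + ⟦ c ⟧ * (1+x * 1+x)
        ≈⟨ solve 4 (λ a b c z → a :* (:- con (+ 1) :* :- con (+ 1)) :+ b :* :- con (+ 1) :* z :+ c :* (z :* z)
             := a :- b :* z :+ c :* (z :* z)) refl ⟦ a ⟧ ⟦ b ⟧ ⟦ c ⟧ 1+x ⟩
      ⟦ a ⟧ - ⟦ b ⟧ * 1+x + ⟦ c ⟧ * (1+x * 1+x)   ∎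

    [x+2]-conjugate : value [x+2] ≈ - 𝟙 * (φ (value [x-1]) * 1+x)
    [x+2]-conjugate = trans
      (solve 1 (λ x → x :+ con (+ 2) := :- con (+ 1) :* (:- con (+ 1) :+ con -[1+ 0 ] :* (con (+ 1) :+ x))) refl x)
      (*-congˡ (sym (φ-linear -[1+ 0 ])))

    [2x+1]-conjugate : value [2x+1] ≈ φ (value [x+2]) * 1+x
    [2x+1]-conjugate = trans
      (solve 1 (λ x → con (+ 2) :* x :+ con (+ 1) := :- con (+ 1) :+ con (+ 2) :* (con (+ 1) :+ x)) refl x)
      (sym (φ-linear (+ 2)))

    [s]-conjugate : value [s] ≈ - 𝟙 * (φ (value [q]) * (1+x * 1+x))
    [s]-conjugate = trans
      (solve 1 (λ x → factorP x [s] := :- con (+ 1) :* (con (+ 1) :- con -[1+ 1 ] :* (con (+ 1) :+ x)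
        :+ con -[1+ 1 ] :* ((con (+ 1) :+ x) :* (con (+ 1) :+ x)))) refl x)
      (*-congˡ (sym (φ-quadratic (+ 1) -[1+ 1 ] -[1+ 1 ])))

    [r]-conjugate : value [r] ≈ - 𝟙 * (φ (value [s]) * (1+x * 1+x))
    [r]-conjugate = trans
      (solve 1 (λ x → factorP x [r] := :- con (+ 1) :* (con (+ 2) :- con (+ 2) :* (con (+ 1) :+ x)
        :+ con -[1+ 0 ] :* ((con (+ 1) :+ x) :* (con (+ 1) :+ x)))) refl x)
      (*-congˡ (sym (φ-quadratic (+ 2) (+ 2) -[1+ 0 ])))

    -1≉0 : ¬ (- 𝟙 ≈ 0#)
    -1≉0 = literal≉0 -[1+ 0 ]

    x+2≉0 : ¬ (value [x+2] ≈ 0#)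
    x+2≉0 = +literal≉0 rotated (+ 2)

    2x+1≉0 : ¬ (value [2x+1] ≈ 0#)
    2x+1≉0 = ≉0-cong (sym [2x+1]-conjugate) (*-≉0 (φ-≉0 x+2≉0) (1+x≉0 rotated))

    [1+x]²≉0 : ¬ (1+x * 1+x ≈ 0#)
    [1+x]²≉0 = *-≉0 (1+x≉0 rotated) (1+x≉0 rotated)

    -- A common zero of a quadratic e and of its conjugate would be a zero of a nonzero multiple of 2x + 1.
    quadratic≉0 : ∀ a b c → (k l m : ℤ) {_ : True (0 ℕ.<? ℤ.∣ m ∣)} {_ : True (ℤ.∣ m ∣ ℕ.≤? 200)} →
      ⟦ k ⟧ * (⟦ a ⟧ * (x * x) + ⟦ b ⟧ * x + ⟦ c ⟧) + ⟦ l ⟧ * (⟦ a ⟧ - ⟦ b ⟧ * 1+x + ⟦ c ⟧ * (1+x * 1+x))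
        ≈ ⟦ m ⟧ * value [2x+1] →
      ¬ (⟦ a ⟧ * (x * x) + ⟦ b ⟧ * x + ⟦ c ⟧ ≈ 0#)
    quadratic≉0 a b c k l m {lo} {hi} eq e≈0 = *-≉0 (literal≉0 m {lo} {hi}) 2x+1≉0 (begin
      ⟦ m ⟧ * value [2x+1]       ≈⟨ eq ⟨
      _                        ≈⟨ +-cong (*-congˡ e≈0) (*-congˡ (sym (φ-quadratic a b c))) ⟩
      ⟦ k ⟧ * 0# + ⟦ l ⟧ * (φ _ * (1+x * 1+x))
                               ≈⟨ +-congˡ (*-congˡ (*-congʳ (trans (φ-cong e≈0) φ-0))) ⟩
      ⟦ k ⟧ * 0# + ⟦ l ⟧ * (0# * (1+x * 1+x))
        ≈⟨ solve 3 (λ k l z → k :* con (+ 0) :+ l :* (con (+ 0) :* z) := con (+ 0)) refl ⟦ k ⟧ ⟦ l ⟧ (1+x * 1+x) ⟩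
      0#                       ∎)

    q≉0 : ¬ (value [q] ≈ 0#)
    -- The multipliers 2 and 1 cancel the leading coefficients 1 and -2 of x² - 2x - 2 and of its
    -- conjugate.
    q≉0 = quadratic≉0 (+ 1) -[1+ 1 ] -[1+ 1 ] (+ 2) (+ 1) -[1+ 2 ]
      (solve 1 (λ x → con (+ 2) :* factorP x [q] :+ con (+ 1) :* (con (+ 1) :- con -[1+ 1 ] :* (con (+ 1) :+ x)
        :+ con -[1+ 1 ] :* ((con (+ 1) :+ x) :* (con (+ 1) :+ x)))
        := con -[1+ 2 ] :* factorP x [2x+1]) refl x)

    s≉0 : ¬ (value [s] ≈ 0#)
    s≉0 = ≉0-cong (sym [s]-conjugate) (*-≉0 -1≉0 (*-≉0 (φ-≉0 q≉0) [1+x]²≉0))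

    value≉0 : ∀ f → ¬ (value f ≈ 0#)
    value≉0 [-1]  = -1≉0
    value≉0 [x]    = x≉0 rotated
    value≉0 [1+x]  = 1+x≉0 rotated
    value≉0 [x-1]  = +literal≉0 rotated -[1+ 0 ]
    value≉0 [x+2]  = x+2≉0
    value≉0 [2x+1] = 2x+1≉0
    value≉0 [q]    = q≉0
    value≉0 [r]    = ≉0-cong (sym [r]-conjugate) (*-≉0 -1≉0 (*-≉0 (φ-≉0 s≉0) [1+x]²≉0))
    value≉0 [s]    = s≉0

    product≉0 : ∀ fs → ¬ (product fs ≈ 0#)
    product≉0 []       = literal≉0 (+ 1)
    product≉0 (f ∷ fs) = *-≉0 (value≉0 f) (product≉0 fs)

    -- Up to norm, every factor is ± 1, ± (x - 1) or ± (x² - 2x - 2).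
    representative : Factor → Carrier
    representative [-1]  = - 𝟙
    representative [x]    = 𝟙
    representative [1+x]  = - 𝟙
    representative [x-1]  = value [x-1]
    representative [x+2]  = value [x-1]
    representative [2x+1] = - 𝟙 * value [x-1]
    representative [q]    = value [q]
    representative [r]    = value [q]
    representative [s]    = - 𝟙 * value [q]

    -- Norms of the factors

    norm-cong₂ : ∀ {a b c d} → norm a ≈ norm c → norm b ≈ norm d → norm (a * b) ≈ norm (c * d)
    norm-cong₂ a∼c b∼d = trans (norm-* _ _) (trans (*-cong a∼c b∼d) (sym (norm-* _ _)))

    -- The rotation gives x φ x = -1 - φ x, and its conjugate gives (1 + φ x) φ² x = -1; so the
    -- product of the three conjugates telescopes to 1.
    norm-x : norm x ≈ norm 𝟙
    norm-x = begin
      norm x                                  ≈⟨ norm-expand x ⟩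
      φ (φ x) * (φ x * x)
        ≈⟨ solve 3 (λ x y z → z :* (y :* x) := z :* (y :* (con (+ 1) :+ x) :- :- con (+ 1)) :- (z :* (con (+ 1) :+ y) :- :- con (+ 1)) :+ con (+ 1)) refl x (φ x) (φ (φ x)) ⟩
      φ (φ x) * (φ x * 1+x - - 𝟙) - (φ (φ x) * (𝟙 + φ x) - - 𝟙) + 𝟙
        ≈⟨ +-congʳ (+-cong (*-congˡ (x≈y⇒x-y≈0 rotated)) (-‿cong (x≈y⇒x-y≈0 rotated'))) ⟩
      φ (φ x) * 0# - 0# + 𝟙
        ≈⟨ solve 1 (λ z → z :* con (+ 0) :- con (+ 0) :+ con (+ 1) := con (+ 1) :* (con (+ 1) :* con (+ 1))) refl (φ (φ x)) ⟩
      𝟙 * (𝟙 * 𝟙)                             ≈⟨ *-cong (trans (φ-cong (φ-⟦⟧ (+ 1))) (φ-⟦⟧ (+ 1))) (*-congʳ (φ-⟦⟧ (+ 1))) ⟨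
      φ (φ 𝟙) * (φ 𝟙 * 𝟙)                     ≈⟨ norm-expand 𝟙 ⟨
      norm 𝟙                                  ∎
      where
      rotated' : φ (φ x) * (𝟙 + φ x) ≈ - 𝟙
      rotated' = begin
        φ (φ x) * (𝟙 + φ x)      ≈⟨ *-congˡ (trans (φ-+ _ _) (+-congʳ (φ-⟦⟧ (+ 1)))) ⟨
        φ (φ x) * φ 1+x          ≈⟨ φ-* _ _ ⟨
        φ (φ x * 1+x)            ≈⟨ φ-cong rotated ⟩
        φ (- 𝟙)                  ≈⟨ φ-⟦⟧ -[1+ 0 ] ⟩
        - 𝟙                      ∎

    -- Take norms in φ x (1 + x) = -1, where φ x has the norm of x, which is that of 1.
    norm-1+x : norm 1+x ≈ norm (- 𝟙)
    norm-1+x = begin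
      norm 1+x             ≈⟨ norm-cong (solve 1 (λ x → x := con (+ 1) :* x) refl 1+x) ⟩
      norm (𝟙 * 1+x)       ≈⟨ norm-cong₂ (sym (trans (norm-φ x) norm-x)) refl ⟩
      norm (φ x * 1+x)     ≈⟨ norm-cong rotated ⟩
      norm (- 𝟙)           ∎

    -- The factor (1 + x)² has norm N(-1)² = 1, so only the sign remains.
    norm-conjugate : ∀ {a b c} → a ≈ - 𝟙 * (φ b * (1+x * 1+x)) → norm b ≈ norm c → norm a ≈ norm (- 𝟙 * c)
    norm-conjugate {a} {b} {c} eq b∼c = begin
      norm a                                ≈⟨ norm-cong eq ⟩
      norm (- 𝟙 * (φ b * (1+x * 1+x)))      ≈⟨ norm-cong₂ refl (norm-cong₂ (trans (norm-φ b) b∼c) (norm-cong₂ norm-1+x norm-1+x)) ⟩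
      norm (- 𝟙 * (c * (- 𝟙 * - 𝟙)))
        ≈⟨ norm-cong (solve 1 (λ c → :- con (+ 1) :* (c :* (:- con (+ 1) :* :- con (+ 1))) := :- con (+ 1) :* c) refl c) ⟩
      norm (- 𝟙 * c)                        ∎

    norm-value : ∀ f → norm (value f) ≈ norm (representative f)
    norm-value [-1]  = refl
    norm-value [x]    = norm-x
    norm-value [1+x]  = norm-1+x
    norm-value [x-1]  = refl
    norm-value [x+2]  = begin
      norm (value [x+2])                          ≈⟨ norm-cong [x+2]-conjugate ⟩
      norm (- 𝟙 * (φ (value [x-1]) * 1+x))        ≈⟨ norm-cong₂ refl (norm-cong₂ (norm-φ _) norm-1+x) ⟩
      norm (- 𝟙 * (value [x-1] * - 𝟙))
        ≈⟨ norm-cong (solve 1 (λ u → :- con (+ 1) :* (u :* :- con (+ 1)) := u) refl (value [x-1])) ⟩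
      norm (value [x-1])                          ∎
    norm-value [2x+1] = begin
      norm (value [2x+1])                         ≈⟨ norm-cong [2x+1]-conjugate ⟩
      norm (φ (value [x+2]) * 1+x)                ≈⟨ norm-cong₂ (trans (norm-φ _) (norm-value [x+2])) norm-1+x ⟩
      norm (value [x-1] * - 𝟙)                    ≈⟨ norm-cong (*-comm _ _) ⟩
      norm (- 𝟙 * value [x-1])                    ∎
    norm-value [q]    = refl
    norm-value [r]    = trans (norm-conjugate [r]-conjugate (norm-value [s])) (norm-cong
      (solve 1 (λ q → :- con (+ 1) :* (:- con (+ 1) :* q) := q) refl (value [q])))
    norm-value [s]    = norm-conjugate [s]-conjugate refl

    representatives : List Factor → Carrier
    representatives []       = 𝟙
    representatives (f ∷ fs) = representative f * representatives fs

    -- Reduces an equality of norms to an identity between monomials in x - 1 and x² - 2x - 2, which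
    -- can be treated as independent variables.
    norm-product : ∀ fs → norm (product fs) ≈ norm (representatives fs)
    norm-product []       = refl
    norm-product (f ∷ fs) = norm-cong₂ (norm-value f) (norm-product fs)

    -- Differences between the six points and the four points

    num den e : Fin 6 → Carrier
    num j = product (numF j)
    den j = product (denF j)
    e j = num j - ⟦ + 2 ⟧ * den j

    -- The row of the point 0: each of the six points has norm 1.
    norm-num : ∀ j → norm (num j) ≈ norm (den j)
    norm-num j = trans (norm-product (numF j)) (trans (norm-cong (eq j)) (sym (norm-product (denF j))))
      where
      eq : ∀ j → representatives (numF j) ≈ representatives (denF j)
      eq 0F = solve 1 (λ u → representativesP u u (numF 0F) := representativesP u u (denF 0F)) refl (value [x-1])
      eq 1F = solve 1 (λ u → representativesP u u (numF 1F) := representativesP u u (denF 1F)) refl (value [x-1])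
      eq 2F = solve 1 (λ u → representativesP u u (numF 2F) := representativesP u u (denF 2F)) refl (value [x-1])
      eq 3F = solve 1 (λ u → representativesP u u (numF 3F) := representativesP u u (denF 3F)) refl (value [x-1])
      eq 4F = solve 1 (λ u → representativesP u u (numF 4F) := representativesP u u (denF 4F)) refl (value [x-1])
      eq 5F = solve 1 (λ u → representativesP u u (numF 5F) := representativesP u u (denF 5F)) refl (value [x-1])

    -- The row of the point -1: each of the six points P has N(P + 1) = -1.
    norm-sum : ∀ j → norm (num j + den j) ≈ norm (- 𝟙 * den j)
    norm-sum j = trans (norm-cong (factors j)) (trans (norm-product (sumF j))
      (trans (norm-cong (eq j)) (norm-cong₂ refl (sym (norm-product (denF j))))))
      where
      factors : ∀ j → num j + den j ≈ product (sumF j)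
      factors 0F = solve 1 (λ x → productP x (numF 0F) :+ productP x (denF 0F) := productP x (sumF 0F)) refl x
      factors 1F = solve 1 (λ x → productP x (numF 1F) :+ productP x (denF 1F) := productP x (sumF 1F)) refl x
      factors 2F = solve 1 (λ x → productP x (numF 2F) :+ productP x (denF 2F) := productP x (sumF 2F)) refl x
      factors 3F = solve 1 (λ x → productP x (numF 3F) :+ productP x (denF 3F) := productP x (sumF 3F)) refl x
      factors 4F = solve 1 (λ x → productP x (numF 4F) :+ productP x (denF 4F) := productP x (sumF 4F)) refl x
      factors 5F = solve 1 (λ x → productP x (numF 5F) :+ productP x (denF 5F) := productP x (sumF 5F)) refl x
      eq : ∀ j → representatives (sumF j) ≈ - 𝟙 * representatives (denF j)
      eq 0F = solve 1 (λ u → representativesP u u (sumF 0F) := :- con (+ 1) :* representativesP u u (denF 0F)) refl (value [x-1])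
      eq 1F = solve 1 (λ u → representativesP u u (sumF 1F) := :- con (+ 1) :* representativesP u u (denF 1F)) refl (value [x-1])
      eq 2F = solve 1 (λ u → representativesP u u (sumF 2F) := :- con (+ 1) :* representativesP u u (denF 2F)) refl (value [x-1])
      eq 3F = solve 1 (λ u → representativesP u u (sumF 3F) := :- con (+ 1) :* representativesP u u (denF 3F)) refl (value [x-1])
      eq 4F = solve 1 (λ u → representativesP u u (sumF 4F) := :- con (+ 1) :* representativesP u u (denF 4F)) refl (value [x-1])
      eq 5F = solve 1 (λ u → representativesP u u (sumF 5F) := :- con (+ 1) :* representativesP u u (denF 5F)) refl (value [x-1])

    -- Equals -6/(θ - 2), because θ - 2 = 6/((x - 1)(x + 2)).
    fourth : Carrier
    fourth = ⟦ + 2 ⟧ - x - x * x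

    -- The row of the point θ: the left argument is (x - 1)(x + 2)(θ - P) times the denominator of
    -- P, and its nontrivial quadratic factor is a conjugate of x² - 2x - 2 up to factors of known
    -- norm.
    norm-fourth : ∀ j → norm (fourth * e j + ⟦ + 6 ⟧ * den j) ≈ norm (value [q] * den j)
    norm-fourth j = trans (norm-cong (factors j)) (trans (norm-product (gF j))
      (trans (norm-cong (eq j)) (norm-cong₂ refl (sym (norm-product (denF j))))))
      where
      gP : ∀ {k} → Polynomial k → Fin 6 → Polynomial k
      gP x j = (con (+ 2) :- x :- x :* x) :* (productP x (numF j) :- con (+ 2) :* productP x (denF j))
        :+ con (+ 6) :* productP x (denF j)
      factors : ∀ j → fourth * e j + ⟦ + 6 ⟧ * den j ≈ product (gF j)
      factors 0F = solve 1 (λ x → gP x 0F := productP x (gF 0F)) refl x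
      factors 1F = solve 1 (λ x → gP x 1F := productP x (gF 1F)) refl x
      factors 2F = solve 1 (λ x → gP x 2F := productP x (gF 2F)) refl x
      factors 3F = solve 1 (λ x → gP x 3F := productP x (gF 3F)) refl x
      factors 4F = solve 1 (λ x → gP x 4F := productP x (gF 4F)) refl x
      factors 5F = solve 1 (λ x → gP x 5F := productP x (gF 5F)) refl x
      eq : ∀ j → representatives (gF j) ≈ value [q] * representatives (denF j)
      eq 0F = solve 2 (λ u q → representativesP u q (gF 0F) := q :* representativesP u q (denF 0F)) refl (value [x-1]) (value [q])
      eq 1F = solve 2 (λ u q → representativesP u q (gF 1F) := q :* representativesP u q (denF 1F)) refl (value [x-1]) (value [q])
      eq 2F = solve 2 (λ u q → representativesP u q (gF 2F) := q :* representativesP u q (denF 2F)) refl (value [x-1]) (value [q])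
      eq 3F = solve 2 (λ u q → representativesP u q (gF 3F) := q :* representativesP u q (denF 3F)) refl (value [x-1]) (value [q])
      eq 4F = solve 2 (λ u q → representativesP u q (gF 4F) := q :* representativesP u q (denF 4F)) refl (value [x-1]) (value [q])
      eq 5F = solve 2 (λ u q → representativesP u q (gF 5F) := q :* representativesP u q (denF 5F)) refl (value [x-1]) (value [q])

    -- None of the six points is the pole 2. The linear cases hold because x is no integer, the
    -- quadratic ones by elimination against the conjugate.
    e≉0 : ∀ j → ¬ (e j ≈ 0#)
    e≉0 0F = ≉0-cong (solve 1 (λ x → x :+ con -[1+ 1 ] := eP x 0F) refl x) (+literal≉0 rotated -[1+ 1 ])
    e≉0 1F = ≉0-cong (solve 1 (λ x → :- con (+ 1) :* (x :+ con (+ 5)) := eP x 1F) refl x)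
      (*-≉0 -1≉0 (+literal≉0 rotated (+ 5)))
    e≉0 2F = ≉0-cong (solve 1 (λ x → con -[1+ 1 ] :* (x :* x) :+ con (+ 2) :* x :+ con (+ 3) := eP x 2F) refl x)
      (quadratic≉0 -[1+ 1 ] (+ 2) (+ 3) (+ 3) (+ 2) (+ 7) (solve 1 (λ x →
        con (+ 3) :* (con -[1+ 1 ] :* (x :* x) :+ con (+ 2) :* x :+ con (+ 3))
          :+ con (+ 2) :* (con -[1+ 1 ] :- con (+ 2) :* (con (+ 1) :+ x) :+ con (+ 3) :* ((con (+ 1) :+ x) :* (con (+ 1) :+ x)))
        := con (+ 7) :* factorP x [2x+1]) refl x))
    e≉0 3F = ≉0-cong (solve 1 (λ x → :- con (+ 1) :* (x :+ con (+ 3)) := eP x 3F) refl x)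
      (*-≉0 -1≉0 (+literal≉0 rotated (+ 3)))
    e≉0 4F = ≉0-cong (solve 1 (λ x → :- con (+ 1) :* (x :+ con -[1+ 3 ]) := eP x 4F) refl x)
      (*-≉0 -1≉0 (+literal≉0 rotated -[1+ 3 ]))
    e≉0 5F = ≉0-cong (solve 1 (λ x → con -[1+ 1 ] :* (x :* x) :+ con -[1+ 5 ] :* x :+ con -[1+ 0 ] := eP x 5F) refl x)
      (quadratic≉0 -[1+ 1 ] -[1+ 5 ] -[1+ 0 ] (+ 1) -[1+ 1 ] -[1+ 6 ] (solve 1 (λ x →
        con (+ 1) :* (con -[1+ 1 ] :* (x :* x) :+ con -[1+ 5 ] :* x :+ con -[1+ 0 ])
          :+ con -[1+ 1 ] :* (con -[1+ 1 ] :- con -[1+ 5 ] :* (con (+ 1) :+ x) :+ con -[1+ 0 ] :* ((con (+ 1) :+ x) :* (con (+ 1) :+ x)))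
        := con -[1+ 6 ] :* factorP x [2x+1]) refl x))

    -- Differences of the points split into factors already known to be nonzero, `hexagonal`, and
    -- Shanks' cubics; the four cubics that occur here are the origin of the exceptional parameters.
    separate : ∀ i j → i Fin.< j → ¬ (num i * den j - num j * den i ≈ 0#)
    separate _ 0F ()
    separate 0F 1F _ = ≉0-cong (solve 1 (λ x → hexP x := crossP x 0F 1F) refl x) hex≉0
    separate 0F 2F _ = ≉0-cong (solve 1 (λ x → shanksP x (+ 0) := crossP x 0F 2F) refl x) (generic 0F)
    separate 0F 3F _ = ≉0-cong (solve 1 (λ x → factorP x [2x+1] := crossP x 0F 3F) refl x) (value≉0 [2x+1])
    separate 0F 4F _ = ≉0-cong (solve 1 (λ x → factorP x [q] := crossP x 0F 4F) refl x) (value≉0 [q])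
    separate 0F 5F _ = ≉0-cong (solve 1 (λ x → productP x ([1+x] ∷ []) :* hexP x := crossP x 0F 5F) refl x)
      (*-≉0 (product≉0 ([1+x] ∷ [])) hex≉0)
    separate (suc _) 1F (s≤s ())
    separate 1F 2F _ = ≉0-cong (solve 1 (λ x → shanksP x (+ 3) := crossP x 1F 2F) refl x) (generic 1F)
    separate 1F 3F _ = ≉0-cong (solve 1 (λ x → factorP x [r] := crossP x 1F 3F) refl x) (value≉0 [r])
    separate 1F 4F _ = ≉0-cong (solve 1 (λ x → con -[1+ 2 ] :* factorP x [2x+1] := crossP x 1F 4F) refl x)
      (*-≉0 (literal≉0 -[1+ 2 ]) (value≉0 [2x+1]))
    separate 1F 5F _ = ≉0-cong (solve 1 (λ x → productP x ([x+2] ∷ []) :* hexP x := crossP x 1F 5F) refl x)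
      (*-≉0 (product≉0 ([x+2] ∷ [])) hex≉0)
    separate (suc (suc _)) 2F (s≤s (s≤s ()))
    separate 2F 3F _ = ≉0-cong (solve 1 (λ x → productP x ([x] ∷ []) :* hexP x := crossP x 2F 3F) refl x)
      (*-≉0 (product≉0 ([x] ∷ [])) hex≉0)
    separate 2F 4F _ = ≉0-cong (solve 1 (λ x → productP x ([-1] ∷ [x-1] ∷ []) :* hexP x := crossP x 2F 4F) refl x)
      (*-≉0 (product≉0 ([-1] ∷ [x-1] ∷ [])) hex≉0)
    separate 2F 5F _ = ≉0-cong (solve 1 (λ x → productP x ([2x+1] ∷ [s] ∷ []) := crossP x 2F 5F) refl x)
      (product≉0 ([2x+1] ∷ [s] ∷ []))
    separate (suc (suc (suc _))) 3F (s≤s (s≤s (s≤s ())))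
    separate 3F 4F _ = ≉0-cong (solve 1 (λ x → productP x ([-1] ∷ []) :* hexP x := crossP x 3F 4F) refl x)
      (*-≉0 (product≉0 ([-1] ∷ [])) hex≉0)
    separate 3F 5F _ = ≉0-cong (solve 1 (λ x → productP x ([-1] ∷ []) :* shanksP x -[1+ 2 ] := crossP x 3F 5F) refl x)
      (*-≉0 (product≉0 ([-1] ∷ [])) (generic 2F))
    separate (suc (suc (suc (suc _)))) 4F (s≤s (s≤s (s≤s (s≤s ()))))
    separate 4F 5F _ = ≉0-cong (solve 1 (λ x → shanksP x -[1+ 5 ] := crossP x 4F 5F) refl x) (generic 3F)
    separate 5F 5F (s≤s (s≤s (s≤s (s≤s (s≤s ())))))

    <-separated⇒injective : ∀ {n} (f : Fin n → Carrier) → (∀ i j → i Fin.< j → ¬ (f i ≈ f j)) →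
      ∀ i j → f i ≈ f j → i ≡ j
    <-separated⇒injective f distinct i j fi≈fj with Fin.<-cmp i j
    ... | tri< i<j _ _ = ⊥-elim (distinct i j i<j fi≈fj)
    ... | tri≈ _ i≡j _ = i≡j
    ... | tri> _ _ j<i = ⊥-elim (distinct j i j<i (sym fi≈fj))

    -- The value 1/(P - 2) at the point P = `num j` / `den j`.
    quot : Fin 6 → Carrier
    quot j = proj₁ (divide (den j) (e≉0 j))

    quot-e : ∀ j → quot j * e j ≈ den j
    quot-e j = proj₂ (divide (den j) (e≉0 j))

    quot≉0 : ∀ j → ¬ (quot j ≈ 0#)
    quot≉0 j eq = product≉0 (denF j) (trans (sym (quot-e j)) (trans (*-congʳ eq) (zeroˡ _)))

    -- A i = -6/(a - 2) for the points a = ∞, 0, -1, θ, and B j = 6/(P - 2) for the points P = num j / den j.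
    A c : Fin 4 → Carrier
    A 0F = ⟦ + 0 ⟧
    A 1F = ⟦ + 3 ⟧
    A 2F = ⟦ + 2 ⟧
    A 3F = fourth
    -- The norms of these are the row factors of the rank-one matrix; -2 joins the scale 2 of its
    -- row with N(P + 1) = N(-1).
    c 0F = ⟦ + 6 ⟧
    c 1F = ⟦ + 3 ⟧
    c 2F = ⟦ -[1+ 1 ] ⟧
    c 3F = value [q]

    c≉0 : ∀ i → ¬ (c i ≈ 0#)
    c≉0 0F = literal≉0 (+ 6)
    c≉0 1F = literal≉0 (+ 3)
    c≉0 2F = literal≉0 -[1+ 1 ]
    c≉0 3F = value≉0 [q]

    A-injective : ∀ i j → A i ≈ A j → i ≡ j
    A-injective = <-separated⇒injective A distinct
      where
      distinct : ∀ i j → i Fin.< j → ¬ (A i ≈ A j)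
      distinct _ 0F ()
      distinct 0F 1F _ eq = literal≉0 (+ 3) (sym eq)
      distinct 0F 2F _ eq = literal≉0 (+ 2) (sym eq)
      distinct 0F 3F _ eq = product≉0 ([-1] ∷ [x-1] ∷ [x+2] ∷ []) (trans
        (solve 1 (λ x → productP x ([-1] ∷ [x-1] ∷ [x+2] ∷ []) := con (+ 2) :- x :- x :* x) refl x) (sym eq))
      distinct (suc _) 1F (s≤s ())
      distinct 1F 2F _ eq = literal≉0 (+ 1) (trans
        (solve 0 (con (+ 1) := con (+ 3) :- con (+ 2)) refl) (x≈y⇒x-y≈0 eq))
      distinct 1F 3F _ eq = hex≉0 (trans
        (solve 1 (λ x → hexP x := con (+ 3) :- (con (+ 2) :- x :- x :* x)) refl x) (x≈y⇒x-y≈0 eq))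
      distinct (suc (suc _)) 2F (s≤s (s≤s ()))
      distinct 2F 3F _ eq = product≉0 ([x] ∷ [1+x] ∷ []) (trans
        (solve 1 (λ x → productP x ([x] ∷ [1+x] ∷ []) := con (+ 2) :- (con (+ 2) :- x :- x :* x)) refl x) (x≈y⇒x-y≈0 eq))
      distinct 3F 3F (s≤s (s≤s (s≤s ())))

    B : Fin 6 → Carrier
    B j = ⟦ + 6 ⟧ * quot j

    B-injective : ∀ i j → B i ≈ B j → i ≡ j
    B-injective = <-separated⇒injective B λ i j i<j eq → separate i j i<j (begin
      num i * den j - num j * den i
        ≈⟨ solve 4 (λ n n' d d' → n :* d' :- n' :* d := (n :- con (+ 2) :* d) :* d' :- (n' :- con (+ 2) :* d') :* d)
             refl (num i) (num j) (den i) (den j) ⟩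
      e i * den j - e j * den i
        ≈⟨ +-cong (*-congˡ (quot-e j)) (-‿cong (*-congˡ (quot-e i))) ⟨
      e i * (quot j * e j) - e j * (quot i * e i)
        ≈⟨ solve 4 (λ q q' e e' → e :* (q' :* e') :- e' :* (q :* e) := e :* e' :* (q' :- q)) refl (quot i) (quot j) (e i) (e j) ⟩
      e i * e j * (quot j - quot i)
        ≈⟨ *-congˡ (x≈y⇒x-y≈0 (*-cancelˡ (literal≉0 (+ 6)) (sym eq))) ⟩
      e i * e j * 0#          ≈⟨ zeroʳ _ ⟩
      0#                      ∎)

    -- Multiplication by `e j` clears the denominator of `B j` and leaves, up to scale, the
    -- difference between the i-th of the four points and the j-th of the six.
    norm-A+B : ∀ i j → norm (A i + B j) ≈ norm (c i) * norm (quot j)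
    norm-A+B i j = *-cancelʳ (norm-≉0 (e≉0 j)) (begin
      norm (A i + B j) * norm (e j)              ≈⟨ norm-* _ _ ⟨
      norm ((A i + B j) * e j)
        ≈⟨ norm-cong (trans (solve 3 (λ a q e → (a :+ con (+ 6) :* q) :* e := a :* e :+ con (+ 6) :* (q :* e)) refl (A i) (quot j) (e j))
             (+-congˡ (*-congˡ (quot-e j)))) ⟩
      norm (A i * e j + ⟦ + 6 ⟧ * den j)         ≈⟨ entry i ⟩
      norm (c i * den j)                         ≈⟨ norm-cong (*-congˡ (quot-e j)) ⟨
      norm (c i * (quot j * e j))                ≈⟨ norm-cong (*-assoc _ _ _) ⟨
      norm (c i * quot j * e j)                  ≈⟨ trans (norm-* _ _) (*-congʳ (norm-* _ _)) ⟩
      norm (c i) * norm (quot j) * norm (e j)    ∎)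
      where
      entry : ∀ i → norm (A i * e j + ⟦ + 6 ⟧ * den j) ≈ norm (c i * den j)
      entry 0F = norm-cong (solve 2 (λ n d → con (+ 0) :* (n :- con (+ 2) :* d) :+ con (+ 6) :* d := con (+ 6) :* d) refl (num j) (den j))
      entry 1F = trans
        (norm-cong (solve 2 (λ n d → con (+ 3) :* (n :- con (+ 2) :* d) :+ con (+ 6) :* d := con (+ 3) :* n) refl (num j) (den j)))
        (norm-cong₂ refl (norm-num j))
      entry 2F = trans
        (norm-cong (solve 2 (λ n d → con (+ 2) :* (n :- con (+ 2) :* d) :+ con (+ 6) :* d := con (+ 2) :* (n :+ d)) refl (num j) (den j)))
        (trans (norm-cong₂ refl (norm-sum j))
          (norm-cong (solve 1 (λ d → con (+ 2) :* (:- con (+ 1) :* d) := con -[1+ 1 ] :* d) refl (den j))))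
      entry 3F = norm-fourth j

    K₄,₆ : ContainsKmn 4 6
    K₄,₆ = build (exists-shift A B (ℕ.m≤m+n 24 176))
      where
      build : (∃ λ s → ∀ i j → ¬ (A i + s ≈ B j - s)) → ContainsKmn 4 6
      build (s , apart) = left , right , left-injective , right-injective ,
        (λ i j eq → apart i j (proj₁ eq)) , (λ i j → (λ eq → apart i j (proj₁ eq)) , adjacent i j)
        where
        -- The row and column factors become the second coordinates; as norms of nonzero elements
        -- they lie in the multiplicative group of the base field.
        left : Fin 4 → Vertex
        left i = A i + s , norm (c i) , norm-inFqStar (c≉0 i)
        right : Fin 6 → Vertex
        right j = B j - s , norm (quot j) , norm-inFqStar (quot≉0 j)
        left-injective : ∀ i j → left i ≈V left j → i ≡ j
        left-injective i j eq = A-injective i j (+-cancelʳ s (A i) (A j) (proj₁ eq))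
        right-injective : ∀ i j → right i ≈V right j → i ≡ j
        right-injective i j eq = B-injective i j (+-cancelʳ (- s) (B i) (B j) (proj₁ eq))
        adjacent : ∀ i j → norm (A i + s + (B j - s)) ≈ norm (c i) * norm (quot j)
        adjacent i j = trans
          (norm-cong (solve 3 (λ a b s → a :+ s :+ (b :- s) := a :+ b) refl (A i) (B j) s)) (norm-A+B i j)

  contains-K₄,₆ : ContainsKmn 4 6
  contains-K₄,₆ = build exists-generic
    where
    build : (∃ λ x → Rotated x × ¬ (hexagonal x ≈ 0#) × Generic x) → ContainsKmn 4 6
    build (x , rotated , hex≉0 , generic) = K₄,₆ rotated hex≉0 generic

-- Every ninth prime

open import Data.Nat using (_+_; _*_; _^_; _!)

exists-prime-divisor : ∀ n → 1 < n → ∃ λ p → Prime p × p ∣ n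
exists-prime-divisor n@(suc _) 1<n with factorise n
... | record { factors = []; isFactorisation = eq } = ⊥-elim (ℕ.<⇒≢ 1<n (≡.sym eq))
... | record { factors = p ∷ ps; isFactorisation = eq; factorsPrime = pr ∷ _ } =
  p , pr , ≡.subst (p ∣_) (≡.sym eq) (m∣m*n (ListAction.product ps))

∣! : ∀ {k n} → 0 < k → k ≤ n → k ∣ n !
∣! {suc k} {n} _ k≤n = ∣-trans (m∣m*n (k !)) (∣-trans (m∣m*n ((n ∸ suc k) !)) (k![n∸k]!∣n! k≤n))

-- Euclid's argument: a prime divisor of n! + 1 that is at most n would divide 1.
exists-prime-above : ∀ n → ∃ λ p → Prime p × n < p
exists-prime-above n with exists-prime-divisor (suc (n !)) (s≤s (ℕ.n≢0⇒n>0 (ℕ.≢-nonZero⁻¹ (n !) {{n ℕ.!≢0}})))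
... | p , pr , p∣1+n! = p , pr , ℕ.≰⇒> λ p≤n →
  ¬prime[1] (≡.subst Prime (∣1⇒≡1 (∣m+n∣m⇒∣n (≡.subst (p ∣_) (ℕ.+-comm 1 (n !)) p∣1+n!)
    (∣! (ℕ.>-nonZero⁻¹ p {{prime⇒nonZero pr}}) p≤n))) pr)

-- Growth of the prime counting function

primeCount-prime : ∀ {n} → Prime (suc n) → primeCount (suc n) ≡ suc (primeCount n)
primeCount-prime {n} pr with prime? (suc n)
... | yes _  = ≡.refl
... | no ¬pr = ⊥-elim (¬pr pr)

primeCount-nonprime : ∀ {n} → ¬ Prime (suc n) → primeCount (suc n) ≡ primeCount n
primeCount-nonprime {n} ¬pr with prime? (suc n)
... | yes pr = ⊥-elim (¬pr pr)
... | no _   = ≡.refl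

countPrimesIn-hit : ∀ {S : Pred ℕ 0ℓ} (S? : Decidable S) n → Prime (suc n) → S (suc n) →
  countPrimesIn S S? (suc n) ≡ suc (countPrimesIn S S? n)
countPrimesIn-hit S? n pr s with prime? (suc n) | S? (suc n)
... | yes _  | yes _ = ≡.refl
... | yes _  | no ¬s = ⊥-elim (¬s s)
... | no ¬pr | _     = ⊥-elim (¬pr pr)

countPrimesIn-miss : ∀ {S : Pred ℕ 0ℓ} (S? : Decidable S) n → ¬ (Prime (suc n) × S (suc n)) →
  countPrimesIn S S? (suc n) ≡ countPrimesIn S S? n
countPrimesIn-miss S? n ¬hit with prime? (suc n) | S? (suc n)
... | yes pr | yes s = ⊥-elim (¬hit (pr , s))
... | yes _  | no _  = ≡.refl
... | no _   | yes _ = ≡.refl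
... | no _   | no _  = ≡.refl

primeCount-step-≤ : ∀ n → primeCount (suc n) ≤ suc (primeCount n)
primeCount-step-≤ n with prime? (suc n)
... | yes _ = ℕ.≤-refl
... | no _  = ℕ.n≤1+n _

primeCount-step-≥ : ∀ n → primeCount n ≤ primeCount (suc n)
primeCount-step-≥ n with prime? (suc n)
... | yes _ = ℕ.n≤1+n _
... | no _  = ℕ.≤-refl

primeCount-mono : ∀ {m n} → m ≤ n → primeCount m ≤ primeCount n
primeCount-mono {m} {n} m≤n = ≡.subst (λ n → primeCount m ≤ primeCount n) (ℕ.m∸n+n≡m m≤n) (go (n ∸ m))
  where
  go : ∀ k → primeCount m ≤ primeCount (k + m)
  go zero    = ℕ.≤-refl
  go (suc k) = ℕ.≤-trans (go k) (primeCount-step-≥ (k + m))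

primeCount≤n : ∀ n → primeCount n ≤ n
primeCount≤n zero    = z≤n
primeCount≤n (suc n) = ℕ.≤-trans (primeCount-step-≤ n) (s≤s (primeCount≤n n))

primeCount-unbounded : ∀ m → ∃ λ n → m ≤ primeCount n
primeCount-unbounded zero = 0 , z≤n
primeCount-unbounded (suc m) with primeCount-unbounded m
... | n , m≤ with exists-prime-above n
...   | suc p , pr , s≤s n≤p = suc p ,
  ≡.subst (suc m ≤_) (≡.sym (primeCount-prime pr)) (s≤s (ℕ.≤-trans m≤ (primeCount-mono n≤p)))

-- Descend from an argument where the count exceeds m to the last one where it still does; the count
-- jumps there, by exactly one.
exists-prime-with-index : ∀ m → ∃ λ p → Prime p × primeCount p ≡ suc m
exists-prime-with-index m = search (proj₁ (primeCount-unbounded (suc m))) (proj₂ (primeCount-unbounded (suc m)))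
  where
  search : ∀ n → suc m ≤ primeCount n → ∃ λ p → Prime p × primeCount p ≡ suc m
  search (suc n) m<π = step (suc m ℕ.≤? primeCount n) (prime? (suc n))
    where
    step : Dec (suc m ≤ primeCount n) → Dec (Prime (suc n)) → ∃ λ p → Prime p × primeCount p ≡ suc m
    step (yes m<π') _      = search n m<π'
    step (no m≮π') (no ¬pr) = ⊥-elim (m≮π' (≡.subst (suc m ≤_) (primeCount-nonprime ¬pr) m<π))
    step (no m≮π') (yes pr) = suc n , pr , ℕ.≤-antisym
      (≡.subst (_≤ suc m) (≡.sym (primeCount-prime pr)) (ℕ.≰⇒> m≮π')) m<π

-- For a prime p, `primeCount p` is its index in the sequence of primes. Bounding the index instead
-- of p makes membership depend on the index alone, and still gives p > 200 because the index is at
-- most p.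
NinthPrime : Pred ℕ 0ℓ
NinthPrime p = Prime p × 9 ∣ primeCount p × 200 < primeCount p

ninthPrime? : Decidable NinthPrime
ninthPrime? p = prime? p ×-dec (9 ∣? primeCount p ×-dec 200 ℕ.<? primeCount p)

ninthPrime-infinite : Infinite NinthPrime
-- One more than this argument is (23 + n) * 9; 23 * 9 = 207 is the first multiple of 9 above 200.
ninthPrime-infinite n = build (exists-prime-with-index (8 + (22 + n) * 9))
  where
  n<index : n < (23 + n) * 9
  n<index = ℕ.<-≤-trans (ℕ.m<n+m n (s≤s z≤n)) (ℕ.m≤m*n (23 + n) 9)
  200<index : 200 < (23 + n) * 9
  200<index = ℕ.≤-trans (ℕ.m≤m+n 201 6) (ℕ.*-monoˡ-≤ 9 (ℕ.m≤m+n 23 n))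
  build : (∃ λ p → Prime p × primeCount p ≡ (23 + n) * 9) → ∃ λ p → n < p × NinthPrime p
  build (p , pr , π≡) = p , ℕ.<-≤-trans (≡.subst (n <_) (≡.sym π≡) n<index) (primeCount≤n p) ,
    pr , ≡.subst (9 ∣_) (≡.sym π≡) (n∣m*n (23 + n)) , ≡.subst (200 <_) (≡.sym π≡) 200<index

-- The counting function is ⌊π(x) / 9⌋ ∸ 22, because 200 < 9 q exactly when 22 < q.
record Counted (x : ℕ) : Set where
  constructor counted
  field
    q r     : ℕ
    r≤8     : r ≤ 8
    index   : primeCount x ≡ r + q * 9
    count   : countPrimesIn NinthPrime ninthPrime? x ≡ q ∸ 22

counts : ∀ x → Counted x
counts zero = counted 0 0 z≤n ≡.refl ≡.refl
counts (suc x) = step (counts x) (prime? (suc x))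
  where
  step : Counted x → Dec (Prime (suc x)) → Counted (suc x)
  step (counted q r r≤8 index count) (no ¬pr) = counted q r r≤8
    (≡.trans (primeCount-nonprime ¬pr) index)
    (≡.trans (countPrimesIn-miss ninthPrime? x (λ (pr , _) → ¬pr pr)) count)
  step (counted q r r≤8 index count) (yes pr) = advance (r ℕ.≟ 8)
    where
    index' : primeCount (suc x) ≡ suc r + q * 9
    index' = ≡.trans (primeCount-prime pr) (≡.cong suc index)
    advance : Dec (r ≡ 8) → Counted (suc x)
    advance (no r≢8) = counted q (suc r) (ℕ.≤∧≢⇒< r≤8 r≢8) index'
      (≡.trans (countPrimesIn-miss ninthPrime? x λ (_ , _ , 9∣π , _) →
        >⇒∤ (s≤s (ℕ.≤∧≢⇒< r≤8 r≢8))
          (∣m+n∣m⇒∣n (≡.subst (9 ∣_) (≡.trans index' (ℕ.+-comm (suc r) (q * 9))) 9∣π) (n∣m*n q))) count)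
    advance (yes ≡.refl) = carry (22 ℕ.≤? q)
      where
      carry : Dec (22 ≤ q) → Counted (suc x)
      carry (yes 22≤q) = counted (suc q) 0 z≤n index'
        (≡.trans (countPrimesIn-hit ninthPrime? x pr
          (pr , ≡.subst (9 ∣_) (≡.sym index') (n∣m*n (suc q)) ,
           ≡.subst (200 <_) (≡.sym index') (ℕ.≤-trans (ℕ.m≤m+n 201 6) (ℕ.*-monoˡ-≤ 9 (s≤s 22≤q)))))
          (≡.trans (≡.cong suc count) (≡.sym (ℕ.+-∸-assoc 1 22≤q))))
      carry (no 22≰q) = counted (suc q) 0 z≤n index'
        (≡.trans (countPrimesIn-miss ninthPrime? x λ (_ , _ , _ , 200<π) →
            ℕ.<⇒≱ (≡.subst (200 <_) index' 200<π)
              (ℕ.≤-trans (ℕ.*-monoˡ-≤ 9 (ℕ.≰⇒> 22≰q)) (ℕ.m≤m+n 198 2)))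
          (≡.trans count (≡.trans (ℕ.m≤n⇒m∸n≡0 (ℕ.<⇒≤ (ℕ.≰⇒> 22≰q))) (≡.sym (ℕ.m≤n⇒m∸n≡0 (ℕ.≰⇒> 22≰q))))))

-- The remainder modulo 9 contributes at most 8, the 22 omitted multiples of 9 at most 198.
discrepancy≤206 : ∀ x → ℤ.∣ + (9 * countPrimesIn NinthPrime ninthPrime? x) ℤ.- + (1 * primeCount x) ∣ ≤ 206
discrepancy≤206 x = bound (counts x)
  where
  open ℕ.≤-Reasoning
  bound : Counted x → ℤ.∣ + (9 * countPrimesIn NinthPrime ninthPrime? x) ℤ.- + (1 * primeCount x) ∣ ≤ 206
  bound (counted q r r≤8 index count) = begin
    ℤ.∣ + (9 * countPrimesIn NinthPrime ninthPrime? x) ℤ.- + (1 * primeCount x) ∣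
      ≡⟨ ≡.cong₂ (λ c π → ℤ.∣ + c ℤ.- + π ∣) (≡.trans (≡.cong (9 *_) count) (ℕ.*-comm 9 (q ∸ 22))) (≡.trans (ℕ.*-identityˡ _) index) ⟩
    ℤ.∣ + ((q ∸ 22) * 9) ℤ.- + (r + q * 9) ∣   ≡⟨ ≡.cong ℤ.∣_∣ (ℤ.m-n≡m⊖n ((q ∸ 22) * 9) (r + q * 9)) ⟩
    ℤ.∣ (q ∸ 22) * 9 ℤ.⊖ (r + q * 9) ∣         ≡⟨ ℤ.∣⊖∣-≤ (ℕ.≤-trans (ℕ.*-monoˡ-≤ 9 (ℕ.m∸n≤m q 22)) (ℕ.m≤n+m (q * 9) r)) ⟩
    r + q * 9 ∸ (q ∸ 22) * 9                   ≤⟨ ℕ.∸-monoˡ-≤ ((q ∸ 22) * 9) (ℕ.+-mono-≤ r≤8 (ℕ.*-monoˡ-≤ 9 (ℕ.m≤n+m∸n q 22))) ⟩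
    8 + (22 + (q ∸ 22)) * 9 ∸ (q ∸ 22) * 9     ≡⟨ ≡.cong (_∸ (q ∸ 22) * 9) (≡.cong (λ y → 8 + y) (ℕ.*-distribʳ-+ 9 22 (q ∸ 22))) ⟩
    206 + (q ∸ 22) * 9 ∸ (q ∸ 22) * 9          ≡⟨ ℕ.m+n∸n≡m 206 ((q ∸ 22) * 9) ⟩
    206                                        ∎

-- The error is bounded while the number of primes is not: 206 < 207 = 9 * 23, so 23 (k + 1) primes
-- suffice for the precision 1/(k + 1).
ninthPrime-density : HasPrimeDensity NinthPrime ninthPrime? 1 9
ninthPrime-density k = build (primeCount-unbounded (23 * suc k))
  where
  open ℕ.≤-Reasoning
  Count : ℕ → ℕ
  Count = countPrimesIn NinthPrime ninthPrime?
  build : (∃ λ N → 23 * suc k ≤ primeCount N) → ∃ λ N → ∀ x → N ≤ x →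
    suc k * ℤ.∣ + (9 * Count x) ℤ.- + (1 * primeCount x) ∣ < 9 * primeCount x
  build (N , 23*[1+k]≤π) = N , λ x N≤x → begin-strict
    suc k * ℤ.∣ + (9 * Count x) ℤ.- + (1 * primeCount x) ∣ ≤⟨ ℕ.*-monoʳ-≤ (suc k) (discrepancy≤206 x) ⟩
    suc k * 206             <⟨ ℕ.*-monoʳ-< (suc k) (ℕ.n<1+n 206) ⟩
    suc k * 207             ≡⟨ ℕ.*-comm (suc k) 207 ⟩
    9 * 23 * suc k          ≡⟨ ℕ.*-assoc 9 23 (suc k) ⟩
    9 * (23 * suc k)        ≤⟨ ℕ.*-monoʳ-≤ 9 (ℕ.≤-trans 23*[1+k]≤π (primeCount-mono N≤x)) ⟩
    9 * primeCount x        ∎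

theorem2 : ∃ λ (S : Pred ℕ 0ℓ) → ∃ λ (S? : Decidable S) →
    (∀ p → S p → Prime p) × Infinite S × HasPrimeDensity S S? 1 9 ×
    (∀ p → S p → (K : CommutativeRing 0ℓ 0ℓ) → IsField K → HasOrder K (p ^ 3) →
    NormGraph.ContainsKmn K p 4 4 6)
theorem2 = NinthPrime , ninthPrime? , (λ _ → proj₁) , ninthPrime-infinite , ninthPrime-density ,
  λ p (pr , _ , 200<π) K isField order →
    Configuration.contains-K₄,₆ K isField p pr order (ℕ.<-≤-trans 200<π (primeCount≤n p))
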